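{- Let $V=V(4,3)$ and let $(M,G,V,\mathcal{E})$ be a homogeneous factorisation of $K_{81}=(V,E)$ of index $5$, in which $M$ is arc-transitive on each factor and each factor is isomorphic to the Hamming graph $H(9,2)$, where $G=T\rtimes G_0\le AGL(4,3)$ is $2$-transitive on $V$, $G_0$ has a normal extraspecial subgroup $\mathbf{E}$ of order $2^5$ with $G_0/\mathbf{E}$ isomorphic to a subgroup of $S_5$, and $M=T\rtimes\mathbf{E}$. Then the maximal cliques (copies of $K_9$) of the five factors give an edge partition of $K_{81}$ into $90$ copies of $K_9$. Letting $\mathcal{B}$ be the set of vertex sets of these $90$ cliques, $\mathcal{D}=(V,\mathcal{B})$ is a $2$-$(81,9,1)$ design; furthermore $G\le\mathrm{Aut}(\mathcal{D})$ is $2$-transitive on the points of $\mathcal{D}$, and $\mathcal{D}$ is an affine plane isomorphic to the exceptional nearfield plane of order $9$.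
   Context: A homogeneous factorisation of index $k>1$ of $K_n=(V,E)$ is a 4-tuple $(M,G,V,\mathcal{E})$ where $\mathcal{E}$ partitions the 2-subsets of $V$ into $k$ parts, $G\le\mathrm{Sym}(V)$ is transitive on $V$, leaves $\mathcal{E}$ invariant and permutes its parts transitively, and the kernel $M$ of this action is transitive on $V$; factors are $(V,E_i)$. $T$ is the translation group of $V$. A $2$-$(v,\kappa,1)$ design is a set of $v$ points with a collection of $\kappa$-subsets (blocks) such that every 2-subset of points lies in exactly one block; its automorphisms are point permutations preserving the block set. $H(9,2)$ has vertices the pairs from a 9-set, adjacent iff they differ in exactly one coordinate. -}

module Defs where

open import Data.Nat using (ℕ; zero; suc)
open import Data.Fin using (Fin)
open import Data.Bool using (Bool; true; false)
open import Data.List using (List; []; _∷_; concatMap; map; filter; length)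
open import Data.Vec using (Vec; []; _∷_; zipWith; foldr) renaming (map to vmap; lookup to vlookup)
open import Data.Product using (Σ; ∃; _×_; _,_; proj₁; proj₂)
open import Data.Sum using (_⊎_)
open import Relation.Binary.PropositionalEquality using (_≡_; _≢_)
open import Relation.Nullary.Decidable using (Dec; yes; no)

infix 2 _iff_
_iff_ : Set → Set → Set
A iff B = (A → B) × (B → A)

data F3 : Set where
  f0 f1 f2 : F3

_+₃_ : F3 → F3 → F3
f0 +₃ y  = y
f1 +₃ f0 = f1
f1 +₃ f1 = f2
f1 +₃ f2 = f0
f2 +₃ f0 = f2
f2 +₃ f1 = f0
f2 +₃ f2 = f1

-₃_ : F3 → F3
-₃ f0 = f0
-₃ f1 = f2
-₃ f2 = f1

_*₃_ : F3 → F3 → F3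
f0 *₃ y  = f0
f1 *₃ y  = y
f2 *₃ y  = -₃ y

V : Set
V = Vec F3 4

_+ᵥ_ : V → V → V
_+ᵥ_ = zipWith _+₃_

dot : ∀ {n} → Vec F3 n → Vec F3 n → F3
dot u v = foldr _ _+₃_ f0 (zipWith _*₃_ u v)

Matrix : Set
Matrix = Vec V 4

_·ᵥ_ : Matrix → V → V
A ·ᵥ x = vmap (λ row → dot row x) A

allVec : (n : ℕ) → List (Vec F3 n)
allVec zero = [] ∷ []
allVec (suc n) = concatMap (λ a → map (a ∷_) (allVec n)) (f0 ∷ f1 ∷ f2 ∷ [])

allV : List V
allV = allVec 4

sizeV : (V → Bool) → ℕ
sizeV S = length (filter (λ x → Data.Bool._≟_ (S x) true) allV)
  where import Data.Bool

record Bij (A B : Set) : Set where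
  field
    to      : A → B
    from    : B → A
    to-from : ∀ y → to (from y) ≡ y
    from-to : ∀ x → from (to x) ≡ x
open Bij public

Perm : Set
Perm = Bij V V

idP : Perm
idP = record { to = λ x → x ; from = λ x → x
             ; to-from = λ _ → Relation.Binary.PropositionalEquality.refl
             ; from-to = λ _ → Relation.Binary.PropositionalEquality.refl }

_∘ₚ_ : Perm → Perm → Perm
g ∘ₚ h = record
  { to = λ x → to g (to h x)
  ; from = λ x → from h (from g x)
  ; to-from = λ y → trans (cong (to g) (to-from h (from g y))) (to-from g y)
  ; from-to = λ x → trans (cong (from h) (from-to g (to h x))) (from-to h x) }
  where open Relation.Binary.PropositionalEquality using (trans; cong)

_⁻¹ₚ : Perm → Perm
g ⁻¹ₚ = record { to = from g ; from = to g ; to-from = from-to g ; from-to = to-from g }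

_≈ₚ_ : Perm → Perm → Set
g ≈ₚ h = ∀ x → to g x ≡ to h x

comm : Perm → Perm → Perm
comm a b = (a ⁻¹ₚ) ∘ₚ ((b ⁻¹ₚ) ∘ₚ (a ∘ₚ b))

record IsSubgroup (H : Perm → Set) : Set where
  field
    resp  : ∀ {g h} → g ≈ₚ h → H g → H h
    id∈   : H idP
    ∘∈    : ∀ {g h} → H g → H h → H (g ∘ₚ h)
    ⁻¹∈   : ∀ {g} → H g → H (g ⁻¹ₚ)

HasSize : (Perm → Set) → ℕ → Set
HasSize H n = Σ (Vec Perm n) λ es →
    (∀ k → H (vlookup es k))
  × (∀ g → H g → ∃ λ k → g ≈ₚ vlookup es k)
  × (∀ j k → vlookup es j ≈ₚ vlookup es k → j ≡ k)

-- AGL(4,3): maps x ↦ A x + b (bijectivity is part of being a Perm)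
IsAffine : Perm → Set
IsAffine g = Σ Matrix λ A → Σ V λ b → ∀ x → to g x ≡ (A ·ᵥ x) +ᵥ b

IsTranslation : Perm → Set
IsTranslation g = Σ V λ b → ∀ x → to g x ≡ x +ᵥ b

zeroV : V
zeroV = f0 ∷ f0 ∷ f0 ∷ f0 ∷ []

Stab0 : (Perm → Set) → Perm → Set
Stab0 G g = G g × (to g zeroV ≡ zeroV)

TwoTransitive : (Perm → Set) → Set
TwoTransitive G = ∀ x y x' y' → x ≢ y → x' ≢ y' →
  ∃ λ g → G g × (to g x ≡ x') × (to g y ≡ y')

Centre : (Perm → Set) → Perm → Set
Centre E g = E g × (∀ h → E h → (g ∘ₚ h) ≈ₚ (h ∘ₚ g))

-- E is an extraspecial group of order 2^5:
-- |E| = 32, |Z(E)| = 2 and E/Z(E) is elementary abelian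
-- (squares and commutators lie in Z(E)).
-- For a 2-group with |Z| = 2 and E ≠ Z this is equivalent to
-- Z(E) = E' = Φ(E) of order 2.
IsExtraspecial32 : (Perm → Set) → Set
IsExtraspecial32 E =
    IsSubgroup E
  × HasSize E 32
  × HasSize (Centre E) 2
  × (∀ a → E a → Centre E (a ∘ₚ a))
  × (∀ a b → E a → E b → Centre E (comm a b))

Normal : (Perm → Set) → (Perm → Set) → Set
Normal N H = ∀ g h → H g → N h → N ((g ∘ₚ h) ∘ₚ (g ⁻¹ₚ))

QuotientEmbedsS5 : (Perm → Set) → (Perm → Set) → Set
QuotientEmbedsS5 H N =
  Σ ((g : Perm) → H g → Fin 5 → Fin 5) λ φ →
      (∀ g h (p : H g) (q : H h) → g ≈ₚ h → ∀ i → φ g p i ≡ φ h q i)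
    × (∀ g h (p : H g) (q : H h) (r : H (g ∘ₚ h)) →
         ∀ i → φ (g ∘ₚ h) r i ≡ φ g p (φ h q i))
    × (∀ g (p : H g) → (∀ i → φ g p i ≡ i) iff N g)

Semidirect : (Perm → Set) → Perm → Set
Semidirect E g = Σ V λ b → Σ Perm λ e → E e × (∀ x → to g x ≡ to e x +ᵥ b)

-- Homogeneous factorisations of K_81 of index 5.
-- The partition 𝓔 of the 2-subsets of V into 5 parts is a symmetric
-- colouring c of unordered pairs {x,y} (x ≢ y); values of c on x = x are
-- irrelevant.

Adj : (V → V → Fin 5) → Fin 5 → V → V → Set
Adj c i x y = (x ≢ y) × (c x y ≡ i)

record HomFact (M G : Perm → Set) (c : V → V → Fin 5) : Set where
  field
    symm        : ∀ x y → x ≢ y → c x y ≡ c y x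
    parts-nonempty : ∀ i → ∃ λ x → ∃ λ y → Adj c i x y
    G-subgroup  : IsSubgroup G
    G-transitive : ∀ x y → ∃ λ g → G g × (to g x ≡ y)
    G-invariant : ∀ g → G g → Σ (Fin 5 → Fin 5) λ σ →
                    ∀ x y → x ≢ y → c (to g x) (to g y) ≡ σ (c x y)
    G-parts-transitive : ∀ i j → ∃ λ g → G g ×
                    (∀ x y → Adj c i x y → c (to g x) (to g y) ≡ j)
    M-kernel    : ∀ g → M g iff
                    (G g × (∀ x y → x ≢ y → c (to g x) (to g y) ≡ c x y))
    M-transitive : ∀ x y → ∃ λ g → M g × (to g x ≡ y)

HamAdj : (Fin 9 × Fin 9) → (Fin 9 × Fin 9) → Set
HamAdj (a , b) (a' , b') = ((a ≡ a') × (b ≢ b')) ⊎ ((a ≢ a') × (b ≡ b'))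

FactorIsoH92 : (V → V → Fin 5) → Fin 5 → Set
FactorIsoH92 c i = Σ (Bij V (Fin 9 × Fin 9)) λ φ →
  ∀ x y → Adj c i x y iff HamAdj (to φ x) (to φ y)

ArcTransitive : (Perm → Set) → (V → V → Fin 5) → Fin 5 → Set
ArcTransitive M c i = ∀ x y x' y' → Adj c i x y → Adj c i x' y' →
  ∃ λ m → M m × (to m x ≡ x') × (to m y ≡ y')

_∈ₛ_ : V → (V → Bool) → Set
x ∈ₛ S = S x ≡ true

IsClique : (V → V → Fin 5) → Fin 5 → (V → Bool) → Set
IsClique c i S = ∀ x y → x ∈ₛ S → y ∈ₛ S → x ≢ y → c x y ≡ i

IsMaxClique : (V → V → Fin 5) → Fin 5 → (V → Bool) → Set
IsMaxClique c i S = IsClique c i S ×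
  (∀ z → S z ≡ false → (∀ x → x ∈ₛ S → c x z ≡ i) → Data.Empty.⊥)
  where import Data.Empty

Block : (V → V → Fin 5) → (V → Bool) → Set
Block c S = ∃ λ i → IsMaxClique c i S

_≐_ : (V → Bool) → (V → Bool) → Set
S ≐ S' = ∀ x → S x ≡ S' x

-- GF(9) = GF(3)[i], i² = -1, and the (Dickson) nearfield of order 9

F9 : Set
F9 = F3 × F3      -- (a , b) represents a + b i

_+₉_ : F9 → F9 → F9
(a , b) +₉ (c , d) = (a +₃ c) , (b +₃ d)

_*₉_ : F9 → F9 → F9
(a , b) *₉ (c , d) = ((a *₃ c) +₃ (-₃ (b *₃ d))) , ((a *₃ d) +₃ (b *₃ c))

frob : F9 → F9
frob (a , b) = a , (-₃ b)

-- norm N(a + b i) = a² + b² ∈ GF(3); a nonzero element is a square in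
-- GF(9)* iff its norm is 1.
norm : F9 → F3
norm (a , b) = (a *₃ a) +₃ (b *₃ b)

-- nearfield multiplication: x ∘ m = x m if m is 0 or a square, x³ m otherwise
_∘ₙ_ : F9 → F9 → F9
x ∘ₙ m with norm m
... | f2 = frob x *₉ m
... | _  = x *₉ m

NearfieldLine : (F9 × F9 → Bool) → Set
NearfieldLine L =
    (Σ F9 λ m → Σ F9 λ b → ∀ p → (L p ≡ true) iff (proj₂ p ≡ (proj₁ p ∘ₙ m) +₉ b))
  ⊎ (Σ F9 λ c → ∀ p → (L p ≡ true) iff (proj₁ p ≡ c))

record Hyp611 (G E : Perm → Set) (c : V → V → Fin 5) : Set where
  field
    homfact      : HomFact (Semidirect E) G c
    arc-trans    : ∀ i → ArcTransitive (Semidirect E) c i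
    factors-H92  : ∀ i → FactorIsoH92 c i
    G-affine     : ∀ g → G g → IsAffine g
    T≤G          : ∀ g → IsTranslation g → G g
    G-2trans     : TwoTransitive G
    E-extraspecial : IsExtraspecial32 E
    E≤G₀         : ∀ g → E g → Stab0 G g
    E-normal     : Normal E (Stab0 G)
    G₀/E≤S₅      : QuotientEmbedsS5 (Stab0 G) E

record Concl611 (G : Perm → Set) (c : V → V → Fin 5) : Set where
  field
    blocks-size9 : ∀ S → Block c S → sizeV S ≡ 9
    ninety       : Σ (Vec (V → Bool) 90) λ bs →
                     (∀ k → Block c (vlookup bs k))
                   × (∀ S → Block c S → ∃ λ k → S ≐ vlookup bs k)
                   × (∀ j k → vlookup bs j ≐ vlookup bs k → j ≡ k)
    cover        : ∀ x y → x ≢ y → ∃ λ S → Block c S × x ∈ₛ S × y ∈ₛ S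
    unique       : ∀ x y S S' → x ≢ y → Block c S → Block c S' →
                     x ∈ₛ S → y ∈ₛ S → x ∈ₛ S' → y ∈ₛ S' → S ≐ S'
    G≤Aut        : ∀ g S → G g → Block c S → Block c (λ x → S (from g x))
    G-2trans     : TwoTransitive G
    nearfield    : Σ (Bij V (F9 × F9)) λ ψ →
                     ∀ S → Block c S iff NearfieldLine (λ p → S (from ψ p))

{-# OPTIONS --safe #-}
module Submission where

-- The centre of E has order 2, so its generator z is fixed under conjugation
-- by the stabiliser of 0; as that stabiliser is transitive on nonzero
-- vectors, z = −1, and squares and commutators in E are ±1. Each colour has
-- 16 < 32 vectors, so some t ≠ 1 in E fixes one of them; then t² = 1, and
-- since t commutes with E up to sign, every vector of that colour is a
-- ±1-eigenvector of t. As t is not central, some g in E swaps its two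
-- eigenspaces, and a clique of the Hamming graph through 0 fills one of
-- them: the two eigenspaces are the maximal cliques through 0 of this colour.
--
-- The involutions t₀, …, t₄ of the five colours anticommute pairwise. Take
-- x with t₀ x = x and put J = t₁ t₂, so that J² = −1; then ℓ(p + q i) =
-- p x + q J x identifies the fixed space of t₀ with GF(9), and (X, Y) ↦
-- ℓ X + t₁ (ℓ Y) identifies V with GF(9)². In these coordinates the
-- eigenspaces of t₀, t₁, t₂ have slopes 0 and ∞, ±1, ±i, and any further tⱼ
-- maps ℓ X to t₁ ℓ(X³ m) with m a nonsquare. So the ten eigenspaces are the
-- lines through the origin of the nearfield plane.

open import Defs
open import Data.Bool using (Bool; true; false; if_then_else_)
import Data.Bool as Bool
open import Data.Bool.Properties using (¬-not)
open import Data.Empty using (⊥; ⊥-elim)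
open import Data.Fin using (Fin; zero; suc; combine; remQuot; join; splitAt)
import Data.Fin as Fin
open import Data.Fin.Patterns using (0F; 1F; 2F; 3F; 4F)
open import Data.Fin.Properties using (pigeonhole; combine-remQuot; remQuot-combine; <⇒≢)
import Data.Fin.Properties as Fin
open import Data.List using (List; []; _∷_; map; filter; cartesianProduct)
open import Data.List.Membership.Propositional using (_∈_; find; lose)
open import Data.List.Membership.Propositional.Properties using (∈-filter⁺; ∈-filter⁻; ∈-map⁺; ∈-map⁻)
open import Data.List.Membership.Propositional.Properties.WithK using (unique∧set⇒bag)
import Data.List.Membership.DecPropositional as DecMembership
open import Data.List.Properties using (length-map)
open import Data.List.Relation.Binary.BagAndSetEquality using (∼bag⇒↭)
open import Data.List.Relation.Binary.Permutation.Propositional.Properties using (↭-length)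
open import Data.List.Relation.Unary.Any using (any?)
import Data.List.Relation.Unary.Unique.DecPropositional as DecUnique
open import Data.List.Relation.Unary.Unique.Propositional using (Unique)
import Data.List.Relation.Unary.Unique.Propositional.Properties as Unique
open import Data.Maybe using (Maybe; just; nothing)
import Data.Maybe.Properties as Maybe
open import Data.Nat using (ℕ; zero; suc; _*_)
import Data.Nat.Properties as ℕ
open import Data.Product using (Σ; ∃; _×_; _,_; proj₁; proj₂; uncurry)
import Data.Product as Product
open import Data.Product.Function.NonDependent.Propositional using (_×-↔_)
import Data.Product.Properties as Product
open import Data.Sum using (_⊎_; inj₁; inj₂; [_,_]′)
open import Data.Sum.Function.Propositional using (_⊎-↔_)
open import Data.Vec using (Vec; []; _∷_; zipWith; lookup; tabulate) renaming (map to vmap)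
open import Data.Vec.Properties
  using (lookup-map; lookup-zipWith; lookup-replicate; tabulate-cong; tabulate∘lookup; lookup∘tabulate)
import Data.Vec.Properties as Vec
open import Function using (_∘_; id)
open import Function.Bundles using (_↔_; mk↔ₛ′; Inverse; Injection; mk⇔)
open import Function.Properties.Inverse using (↔-trans; ↔⇒↣)
open import Relation.Binary.Definitions using (DecidableEquality)
open import Relation.Binary.PropositionalEquality
  using (_≡_; _≢_; refl; sym; trans; cong; cong₂; subst; module ≡-Reasoning)
open import Relation.Nullary using (¬_; contradiction)
open import Relation.Nullary.Decidable
  using (Dec; does; yes; no; map′; True; toWitness; from-yes; decidable-stable; ¬?; _×-dec_; _⊎-dec_; _→-dec_)

-- Linear algebra over GF(3)

_≟₃_ : DecidableEquality F3
f0 ≟₃ f0 = yes refl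
f0 ≟₃ f1 = no λ ()
f0 ≟₃ f2 = no λ ()
f1 ≟₃ f0 = no λ ()
f1 ≟₃ f1 = yes refl
f1 ≟₃ f2 = no λ ()
f2 ≟₃ f0 = no λ ()
f2 ≟₃ f1 = no λ ()
f2 ≟₃ f2 = yes refl

_≟ᵥ_ : DecidableEquality V
_≟ᵥ_ = Vec.≡-dec _≟₃_

_≟₉_ : DecidableEquality F9
_≟₉_ = Product.≡-dec _≟₃_ _≟₃_

-- Finite universal statements are decided by enumeration, so identities over GF(3) and GF(9) can be
-- proved by evaluation with `from-yes`.
all₃? : {P : F3 → Set} → (∀ a → Dec (P a)) → Dec (∀ a → P a)
all₃? P? with P? f0 | P? f1 | P? f2
... | no ¬p | _ | _ = no λ p → ¬p (p f0)
... | yes _ | no ¬p | _ = no λ p → ¬p (p f1)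
... | yes _ | yes _ | no ¬p = no λ p → ¬p (p f2)
... | yes p₀ | yes p₁ | yes p₂ = yes λ { f0 → p₀ ; f1 → p₁ ; f2 → p₂ }

all₉? : {P : F9 → Set} → (∀ a → Dec (P a)) → Dec (∀ a → P a)
all₉? P? = map′ uncurry (λ p a b → p (a , b)) (all₃? λ a → all₃? λ b → P? (a , b))

allVec? : ∀ {n} {P : Vec F3 n → Set} → (∀ a → Dec (P a)) → Dec (∀ a → P a)
allVec? {zero} P? = map′ (λ { p [] → p }) (λ p → p []) (P? [])
allVec? {suc n} P? =
  map′ (λ { p (a ∷ as) → p a as }) (λ p a as → p (a ∷ as)) (all₃? λ a → allVec? λ as → P? (a ∷ as))

-- −u is written f2 ∙ u throughout.
_∙_ : F3 → V → V
s ∙ u = vmap (s *₃_) u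

-- Identities between linear combinations: V is a power of GF(3), so it
-- suffices to check them on all valuations in GF(3).
data Expr (n : ℕ) : Set where
  var : Fin n → Expr n
  _⊕_ : Expr n → Expr n → Expr n
  _⊙_ : F3 → Expr n → Expr n
  𝟘   : Expr n

infixl 6 _⊕_
infixr 7 _⊙_

⟦_⟧₃ : ∀ {n} → Expr n → Vec F3 n → F3
⟦ var i ⟧₃ σ = lookup σ i
⟦ a ⊕ b ⟧₃ σ = ⟦ a ⟧₃ σ +₃ ⟦ b ⟧₃ σ
⟦ s ⊙ a ⟧₃ σ = s *₃ ⟦ a ⟧₃ σ
⟦ 𝟘 ⟧₃ σ = f0

⟦_⟧ : ∀ {n} → Expr n → Vec V n → V
⟦ var i ⟧ ρ = lookup ρ i
⟦ a ⊕ b ⟧ ρ = ⟦ a ⟧ ρ +ᵥ ⟦ b ⟧ ρ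
⟦ s ⊙ a ⟧ ρ = s ∙ ⟦ a ⟧ ρ
⟦ 𝟘 ⟧ ρ = zeroV

lookup-⟦⟧ : ∀ {n} (a : Expr n) ρ k → lookup (⟦ a ⟧ ρ) k ≡ ⟦ a ⟧₃ (vmap (λ u → lookup u k) ρ)
lookup-⟦⟧ (var i) ρ k = sym (lookup-map i _ ρ)
lookup-⟦⟧ (a ⊕ b) ρ k = trans (lookup-zipWith _+₃_ k (⟦ a ⟧ ρ) (⟦ b ⟧ ρ))
  (cong₂ _+₃_ (lookup-⟦⟧ a ρ k) (lookup-⟦⟧ b ρ k))
lookup-⟦⟧ (s ⊙ a) ρ k = trans (lookup-map k (s *₃_) (⟦ a ⟧ ρ)) (cong (s *₃_) (lookup-⟦⟧ a ρ k))
lookup-⟦⟧ 𝟘 ρ k = lookup-replicate k f0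

lookup-ext : ∀ {n} {u v : Vec F3 n} → (∀ k → lookup u k ≡ lookup v k) → u ≡ v
lookup-ext {u = u} {v} eq = trans (sym (tabulate∘lookup u)) (trans (tabulate-cong eq) (tabulate∘lookup v))

_≈ₑ_ : ∀ {n} → Expr n → Expr n → Set
a ≈ₑ b = ∀ σ → ⟦ a ⟧₃ σ ≡ ⟦ b ⟧₃ σ

_≈ₑ?_ : ∀ {n} (a b : Expr n) → Dec (a ≈ₑ b)
a ≈ₑ? b = allVec? λ σ → ⟦ a ⟧₃ σ ≟₃ ⟦ b ⟧₃ σ

⟦⟧-cong : ∀ {n} (a b : Expr n) → a ≈ₑ b → ∀ ρ → ⟦ a ⟧ ρ ≡ ⟦ b ⟧ ρ
⟦⟧-cong a b a≈b ρ = lookup-ext λ k →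
  trans (lookup-⟦⟧ a ρ k) (trans (a≈b _) (sym (lookup-⟦⟧ b ρ k)))

identity : ∀ {n} (a b : Expr n) {_ : True (a ≈ₑ? b)} ρ → ⟦ a ⟧ ρ ≡ ⟦ b ⟧ ρ
identity a b {a≈b} = ⟦⟧-cong a b (toWitness a≈b)

pattern X₀ = var 0F
pattern X₁ = var 1F
pattern X₂ = var 2F
pattern X₃ = var 3F

+ᵥ-identityˡ : ∀ u → zeroV +ᵥ u ≡ u
+ᵥ-identityˡ u = identity (𝟘 ⊕ X₀) X₀ (u ∷ [])

+ᵥ-identityʳ : ∀ u → u +ᵥ zeroV ≡ u
+ᵥ-identityʳ u = identity (X₀ ⊕ 𝟘) X₀ (u ∷ [])

+ᵥ-comm : ∀ u v → u +ᵥ v ≡ v +ᵥ u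
+ᵥ-comm u v = identity (X₀ ⊕ X₁) (X₁ ⊕ X₀) (u ∷ v ∷ [])

-‿involutive : ∀ u → f2 ∙ (f2 ∙ u) ≡ u
-‿involutive u = identity (f2 ⊙ f2 ⊙ X₀) X₀ (u ∷ [])

-‿selfInverse : ∀ {u v} → u ≡ f2 ∙ v → v ≡ f2 ∙ u
-‿selfInverse {v = v} eq = trans (sym (-‿involutive v)) (cong (f2 ∙_) (sym eq))

-- In characteristic 3, u = -(u + u), and the hypothesis turns u + u into u - u.
u≡-u⇒u≡0 : ∀ {u} → u ≡ f2 ∙ u → u ≡ zeroV
u≡-u⇒u≡0 {u} eq = begin
  u                 ≡⟨ identity X₀ (f2 ⊙ (X₀ ⊕ X₀)) (u ∷ []) ⟩
  f2 ∙ (u +ᵥ u)     ≡⟨ cong (λ w → f2 ∙ (u +ᵥ w)) eq ⟩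
  f2 ∙ (u +ᵥ (f2 ∙ u)) ≡⟨ identity (f2 ⊙ (X₀ ⊕ f2 ⊙ X₀)) 𝟘 (u ∷ []) ⟩
  zeroV             ∎
  where open ≡-Reasoning

u-v≡0⇒u≡v : ∀ {u v} → u +ᵥ (f2 ∙ v) ≡ zeroV → u ≡ v
u-v≡0⇒u≡v {u} {v} eq = begin
  u                      ≡⟨ identity X₀ ((X₀ ⊕ f2 ⊙ X₁) ⊕ X₁) (u ∷ v ∷ []) ⟩
  (u +ᵥ (f2 ∙ v)) +ᵥ v   ≡⟨ cong (_+ᵥ v) eq ⟩
  zeroV +ᵥ v             ≡⟨ +ᵥ-identityˡ v ⟩
  v                      ∎
  where open ≡-Reasoning

u+v≡0⇒v≡-u : ∀ {u v} → u +ᵥ v ≡ zeroV → v ≡ f2 ∙ u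
u+v≡0⇒v≡-u {u} {v} eq = begin
  v                      ≡⟨ identity X₁ ((X₀ ⊕ X₁) ⊕ f2 ⊙ X₀) (u ∷ v ∷ []) ⟩
  (u +ᵥ v) +ᵥ (f2 ∙ u)   ≡⟨ cong (_+ᵥ (f2 ∙ u)) eq ⟩
  zeroV +ᵥ (f2 ∙ u)      ≡⟨ +ᵥ-identityˡ _ ⟩
  f2 ∙ u                 ∎
  where open ≡-Reasoning

Additive : (V → V) → Set
Additive f = ∀ u v → f (u +ᵥ v) ≡ f u +ᵥ f v

module _ {f : V → V} (f-+ : Additive f) where
  open ≡-Reasoning

  -- Over a prime field additivity already gives linearity: the scalars are 0, 1 and 1 + 1.
  additive-∙ : ∀ s u → f (s ∙ u) ≡ s ∙ f u
  additive-∙ f0 u = begin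
    f (f0 ∙ u)                 ≡⟨ cong f (identity (f0 ⊙ X₀) 𝟘 (u ∷ [])) ⟩
    f zeroV                    ≡⟨ identity X₀ ((X₀ ⊕ X₀) ⊕ f2 ⊙ X₀) (f zeroV ∷ []) ⟩
    (f zeroV +ᵥ f zeroV) +ᵥ (f2 ∙ f zeroV) ≡⟨ cong (_+ᵥ (f2 ∙ f zeroV)) (sym (f-+ zeroV zeroV)) ⟩
    f zeroV +ᵥ (f2 ∙ f zeroV)  ≡⟨ identity (X₀ ⊕ f2 ⊙ X₀) (f0 ⊙ X₁) (f zeroV ∷ f u ∷ []) ⟩
    f0 ∙ f u                   ∎
  additive-∙ f1 u = begin
    f (f1 ∙ u)  ≡⟨ cong f (identity (f1 ⊙ X₀) X₀ (u ∷ [])) ⟩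
    f u         ≡⟨ identity X₀ (f1 ⊙ X₀) (f u ∷ []) ⟩
    f1 ∙ f u    ∎
  additive-∙ f2 u = begin
    f (f2 ∙ u)   ≡⟨ cong f (identity (f2 ⊙ X₀) (X₀ ⊕ X₀) (u ∷ [])) ⟩
    f (u +ᵥ u)   ≡⟨ f-+ u u ⟩
    f u +ᵥ f u   ≡⟨ identity (X₀ ⊕ X₀) (f2 ⊙ X₀) (f u ∷ []) ⟩
    f2 ∙ f u     ∎

  additive-0 : f zeroV ≡ zeroV
  additive-0 = trans (additive-∙ f0 zeroV) (identity (f0 ⊙ X₀) 𝟘 (f zeroV ∷ []))

  additive-sub : ∀ u v → f (u +ᵥ (f2 ∙ v)) ≡ f u +ᵥ (f2 ∙ f v)
  additive-sub u v = trans (f-+ u (f2 ∙ v)) (cong (f u +ᵥ_) (additive-∙ f2 v))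

opaque
  +₃-interchange : ∀ a b c d → (a +₃ b) +₃ (c +₃ d) ≡ (a +₃ c) +₃ (b +₃ d)
  +₃-interchange = from-yes (all₃? λ a → all₃? λ b → all₃? λ c → all₃? λ d →
    ((a +₃ b) +₃ (c +₃ d)) ≟₃ ((a +₃ c) +₃ (b +₃ d)))

opaque
  *₃-distribˡ : ∀ a b c → a *₃ (b +₃ c) ≡ (a *₃ b) +₃ (a *₃ c)
  *₃-distribˡ = from-yes (all₃? λ a → all₃? λ b → all₃? λ c → (a *₃ (b +₃ c)) ≟₃ ((a *₃ b) +₃ (a *₃ c)))

dot-+ : ∀ {n} (r u v : Vec F3 n) → dot r (zipWith _+₃_ u v) ≡ dot r u +₃ dot r v
dot-+ [] [] [] = refl
dot-+ (r ∷ rs) (u ∷ us) (v ∷ vs) = begin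
  (r *₃ (u +₃ v)) +₃ dot rs (zipWith _+₃_ us vs)
    ≡⟨ cong₂ _+₃_ (*₃-distribˡ r u v) (dot-+ rs us vs) ⟩
  ((r *₃ u) +₃ (r *₃ v)) +₃ (dot rs us +₃ dot rs vs)
    ≡⟨ +₃-interchange (r *₃ u) (r *₃ v) (dot rs us) (dot rs vs) ⟩
  ((r *₃ u) +₃ dot rs us) +₃ ((r *₃ v) +₃ dot rs vs) ∎
  where open ≡-Reasoning

·ᵥ-additive : ∀ A → Additive (A ·ᵥ_)
·ᵥ-additive A u v = lookup-ext λ k → begin
  lookup (A ·ᵥ (u +ᵥ v)) k  ≡⟨ lookup-map k _ A ⟩
  dot (lookup A k) (u +ᵥ v) ≡⟨ dot-+ (lookup A k) u v ⟩
  dot (lookup A k) u +₃ dot (lookup A k) v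
    ≡⟨ cong₂ _+₃_ (sym (lookup-map k _ A)) (sym (lookup-map k _ A)) ⟩
  lookup (A ·ᵥ u) k +₃ lookup (A ·ᵥ v) k ≡⟨ sym (lookup-zipWith _+₃_ k (A ·ᵥ u) (A ·ᵥ v)) ⟩
  lookup ((A ·ᵥ u) +ᵥ (A ·ᵥ v)) k ∎
  where open ≡-Reasoning

-- The translation part is the image of 0, so it vanishes and only the linear part remains.
affine⇒additive : ∀ {g} → IsAffine g → to g zeroV ≡ zeroV → Additive (to g)
affine⇒additive {g} (A , b , g≡A+b) g0≡0 u v = begin
  to g (u +ᵥ v)          ≡⟨ g≡A (u +ᵥ v) ⟩
  A ·ᵥ (u +ᵥ v)          ≡⟨ ·ᵥ-additive A u v ⟩
  (A ·ᵥ u) +ᵥ (A ·ᵥ v)   ≡⟨ sym (cong₂ _+ᵥ_ (g≡A u) (g≡A v)) ⟩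
  to g u +ᵥ to g v       ∎
  where
  open ≡-Reasoning
  b≡0 : b ≡ zeroV
  b≡0 = begin
    b                      ≡⟨ sym (+ᵥ-identityˡ b) ⟩
    zeroV +ᵥ b             ≡⟨ cong (_+ᵥ b) (sym (additive-0 (·ᵥ-additive A))) ⟩
    (A ·ᵥ zeroV) +ᵥ b      ≡⟨ sym (g≡A+b zeroV) ⟩
    to g zeroV             ≡⟨ g0≡0 ⟩
    zeroV                  ∎
  g≡A : ∀ x → to g x ≡ A ·ᵥ x
  g≡A x = begin
    to g x             ≡⟨ g≡A+b x ⟩
    (A ·ᵥ x) +ᵥ b      ≡⟨ cong ((A ·ᵥ x) +ᵥ_) b≡0 ⟩
    (A ·ᵥ x) +ᵥ zeroV  ≡⟨ +ᵥ-identityʳ _ ⟩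
    A ·ᵥ x             ∎

-- Bijections and counting on finite sets

to-injective : ∀ {A B} (f : Bij A B) {x y} → to f x ≡ to f y → x ≡ y
to-injective f {x} {y} eq = trans (sym (from-to f x)) (trans (cong (from f) eq) (from-to f y))

from-injective : ∀ {A B} (f : Bij A B) {x y} → from f x ≡ from f y → x ≡ y
from-injective f {x} {y} eq = trans (sym (to-from f x)) (trans (cong (to f) eq) (to-from f y))

_⨾_ : ∀ {A B C} → Bij A B → Bij B C → Bij A C
f ⨾ g = record
  { to = to g ∘ to f
  ; from = from f ∘ from g
  ; to-from = λ y → trans (cong (to g) (to-from f (from g y))) (to-from g y)
  ; from-to = λ x → trans (cong (from f) (from-to g (to f x))) (from-to f x)
  }

combineᵇ : ∀ m n → Bij (Fin m × Fin n) (Fin (m * n))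
combineᵇ m n = record
  { to = uncurry combine
  ; from = remQuot {m} n
  ; to-from = combine-remQuot {m} n
  ; from-to = uncurry (remQuot-combine {m} {n})
  }

opaque
  -- Pigeonhole on the n + 1 elements consisting of w and all values of f: by injectivity of f, a
  -- collision must involve w.
  injective⇒surjective : ∀ {A n} (φ : Bij A (Fin n)) (f : A → A) →
    (∀ {x y} → f x ≡ f y → x ≡ y) → ∀ w → ∃ λ x → f x ≡ w
  injective⇒surjective {n = n} φ f f-injective w with pigeonhole (ℕ.n<1+n n)
    (λ { zero → to φ w ; (suc k) → to φ (f (from φ k)) })
  ... | zero , suc k , _ , eq = from φ k , sym (to-injective φ eq)
  ... | suc j , suc k , j<k , eq =
    contradiction (cong suc (from-injective φ (f-injective (to-injective φ eq)))) (<⇒≢ j<k)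
  ... | zero , zero , () , _
  ... | suc _ , zero , () , _

-- A constructive substitute for excluded middle: neither P nor Q has to be decidable. It serves to
-- find an element of E that anticommutes with a given one.
every⊎some : ∀ {n} {P Q : Fin n → Set} → (∀ k → P k ⊎ Q k) → (∀ k → P k) ⊎ ∃ Q
every⊎some {zero} _ = inj₁ λ ()
every⊎some {suc n} d with d zero | every⊎some (d ∘ suc)
... | inj₂ q | _ = inj₂ (zero , q)
... | inj₁ _ | inj₂ (k , q) = inj₂ (suc k , q)
... | inj₁ p | inj₁ ps = inj₁ λ { zero → p ; (suc k) → ps k }

-- The nearfield of order 9

0₉ 1₉ i₉ : F9
0₉ = f0 , f0
1₉ = f1 , f0
i₉ = f0 , f1

0₉≢1₉ : 0₉ ≢ 1₉
0₉≢1₉ ()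

-₉_ : F9 → F9
-₉ (a , b) = (-₃ a) , (-₃ b)

-- Solves x ∘ₙ m = y for m. The inverse of x is `norm x` times its conjugate, as nonzero norms are
-- their own inverses. The Frobenius map preserves norms, so q has the norm of m in either case and
-- tells whether x or its conjugate has to be divided out.
_/ₙ_ : F9 → F9 → F9
y /ₙ x = (if does (norm q ≟₃ f2) then frob x⁻¹ else x⁻¹) *₉ y
  where
  x⁻¹ q : F9
  x⁻¹ = (norm x , f0) *₉ frob x
  q = x⁻¹ *₉ y

opaque
  /ₙ-∘ₙ : ∀ x m → x ≢ 0₉ → (x ∘ₙ m) /ₙ x ≡ m
  /ₙ-∘ₙ = from-yes (all₉? λ x → all₉? λ m → ¬? (x ≟₉ 0₉) →-dec (((x ∘ₙ m) /ₙ x) ≟₉ m))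

opaque
  ∘ₙ-/ₙ : ∀ x y → x ≢ 0₉ → y ≡ x ∘ₙ (y /ₙ x)
  ∘ₙ-/ₙ = from-yes (all₉? λ x → all₉? λ y → ¬? (x ≟₉ 0₉) →-dec (y ≟₉ (x ∘ₙ (y /ₙ x))))

opaque
  -- For fixed m, the map x ↦ x ∘ₙ m is the identity or the Frobenius map followed by a field
  -- multiplication, hence additive.
  ∘ₙ-distribʳ : ∀ m x y → (x +₉ y) ∘ₙ m ≡ (x ∘ₙ m) +₉ (y ∘ₙ m)
  ∘ₙ-distribʳ = from-yes (all₉? λ m → all₉? λ x → all₉? λ y → ((x +₉ y) ∘ₙ m) ≟₉ ((x ∘ₙ m) +₉ (y ∘ₙ m)))

-- Points of F9 × F9 and their slopes; nothing is the vertical direction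

Point : Set
Point = F9 × F9

0ₚ : Point
0ₚ = 0₉ , 0₉

_-ₚ_ : Point → Point → Point
(x , y) -ₚ (x' , y') = (x +₉ (-₉ x')) , (y +₉ (-₉ y'))

Slope : Set
Slope = Maybe F9

_≟ₛ_ : DecidableEquality Slope
_≟ₛ_ = Maybe.≡-dec _≟₉_

allSlopes? : {P : Slope → Set} → (∀ n → Dec (P n)) → Dec (∀ n → P n)
allSlopes? P? with P? nothing | all₉? (P? ∘ just)
... | no ¬p | _ = no λ p → ¬p (p nothing)
... | yes _ | no ¬p = no λ p → ¬p (p ∘ just)
... | yes p | yes ps = yes λ { nothing → p ; (just m) → ps m }

On : Slope → Point → Set
On (just m) (x , y) = y ≡ x ∘ₙ m
On nothing (x , y) = x ≡ 0₉

-- Together with `On-unique` this makes the ten lines through the origin a spread: they partition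
-- the nonzero points.
On-exists : ∀ p → ∃ λ n → On n p
On-exists (x , y) with x ≟₉ 0₉
... | yes x≡0 = nothing , x≡0
... | no x≢0 = just (y /ₙ x) , ∘ₙ-/ₙ x y x≢0

opaque
  0∘ₙ : ∀ m → 0₉ ∘ₙ m ≡ 0₉
  0∘ₙ = from-yes (all₉? λ m → (0₉ ∘ₙ m) ≟₉ 0₉)

-- A nonzero point of a sloped line has x ≠ 0, so division by x recovers the slope.
On-unique : ∀ n n' p → p ≢ 0ₚ → On n p → On n' p → n ≡ n'
On-unique nothing nothing _ _ _ _ = refl
On-unique nothing (just m) _ p≢0 refl refl = contradiction (cong (0₉ ,_) (0∘ₙ m)) p≢0
On-unique (just m) nothing _ p≢0 refl refl = contradiction (cong (0₉ ,_) (0∘ₙ m)) p≢0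
On-unique (just m) (just m') (x , _) p≢0 refl x∘m≡x∘m' = cong just (begin
  m                  ≡⟨ sym (/ₙ-∘ₙ x m x≢0) ⟩
  (x ∘ₙ m) /ₙ x      ≡⟨ cong (_/ₙ x) x∘m≡x∘m' ⟩
  (x ∘ₙ m') /ₙ x     ≡⟨ /ₙ-∘ₙ x m' x≢0 ⟩
  m'                 ∎)
  where
  open ≡-Reasoning
  x≢0 : x ≢ 0₉
  x≢0 refl = p≢0 (cong (0₉ ,_) (0∘ₙ m))

opaque
  -‿∘ₙ : ∀ x m → (-₉ x) ∘ₙ m ≡ -₉ (x ∘ₙ m)
  -‿∘ₙ = from-yes (all₉? λ x → all₉? λ m → ((-₉ x) ∘ₙ m) ≟₉ (-₉ (x ∘ₙ m)))

opaque
  ∘ₙ-‿- : ∀ x m → x ∘ₙ (-₉ m) ≡ -₉ (x ∘ₙ m)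
  ∘ₙ-‿- = from-yes (all₉? λ x → all₉? λ m → (x ∘ₙ (-₉ m)) ≟₉ (-₉ (x ∘ₙ m)))

∘ₙ-sub : ∀ m x x' → (x +₉ (-₉ x')) ∘ₙ m ≡ (x ∘ₙ m) +₉ (-₉ (x' ∘ₙ m))
∘ₙ-sub m x x' = trans (∘ₙ-distribʳ m x (-₉ x')) (cong ((x ∘ₙ m) +₉_) (-‿∘ₙ x' m))

-- By distributivity each line through the origin is an additive subgroup.
On-sub : ∀ n {p q} → On n p → On n q → On n (p -ₚ q)
On-sub nothing refl refl = refl
On-sub (just m) {x , _} {x' , _} refl refl = sym (∘ₙ-sub m x x')

-- The two slopes ±m, resp. 0 and ∞, of one colour

mate : Slope → Slope
mate nothing = just 0₉
mate (just (f0 , f0)) = nothing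
mate (just m) = just (-₉ m)

-- The classes are {∞, 0}, {±1}, {±i}, {±(1 + i)} and {±(1 - i)}; the last two consist of the
-- nonsquares of GF(9).
mateClass : Slope → Fin 5
mateClass nothing          = 0F
mateClass (just (f0 , f0)) = 0F
mateClass (just (_  , f0)) = 1F
mateClass (just (f0 , _))  = 2F
mateClass (just (f1 , f1)) = 3F
mateClass (just (f2 , f2)) = 3F
mateClass (just (f1 , f2)) = 4F
mateClass (just (f2 , f1)) = 4F

opaque
  mateClass-injective : ∀ n n' → mateClass n ≡ mateClass n' → (n' ≡ n) ⊎ (n' ≡ mate n)
  mateClass-injective = from-yes (allSlopes? λ n → allSlopes? λ n' →
    (mateClass n Fin.≟ mateClass n') →-dec ((n' ≟ₛ n) ⊎-dec (n' ≟ₛ mate n)))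

opaque
  1∘ₙ : ∀ m → m ≡ 1₉ ∘ₙ m
  1∘ₙ = from-yes (all₉? λ m → m ≟₉ (1₉ ∘ₙ m))

-- The involutions of the five colours

translation : V → Perm
translation b = record
  { to = _+ᵥ b
  ; from = _+ᵥ (f2 ∙ b)
  ; to-from = λ x → identity ((X₀ ⊕ f2 ⊙ X₁) ⊕ X₁) X₀ (x ∷ b ∷ [])
  ; from-to = λ x → identity ((X₀ ⊕ X₁) ⊕ f2 ⊙ X₁) X₀ (x ∷ b ∷ [])
  }

_±Eigen_ : Perm → V → Set
t ±Eigen u = (to t u ≡ u) ⊎ (to t u ≡ f2 ∙ u)

Commute Anticommute : Perm → Perm → Set
Commute g h = ∀ x → to g (to h x) ≡ to h (to g x)
Anticommute g h = ∀ x → to g (to h x) ≡ f2 ∙ to h (to g x)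

module Factorisation (G E : Perm → Set) (c : V → V → Fin 5) (H : Hyp611 G E c) where
  open Hyp611 H
  open HomFact homfact
  open ≡-Reasoning

  E-subgroup : IsSubgroup E
  E-subgroup = proj₁ E-extraspecial

  E-size : HasSize E 32
  E-size = proj₁ (proj₂ E-extraspecial)

  open IsSubgroup E-subgroup

  e : Fin 32 → Perm
  e = lookup (proj₁ E-size)

  e∈E : ∀ k → E (e k)
  e∈E = proj₁ (proj₂ E-size)

  e-surjective : ∀ g → E g → ∃ λ k → g ≈ₚ e k
  e-surjective = proj₁ (proj₂ (proj₂ E-size))

  e-injective : ∀ j k → e j ≈ₚ e k → j ≡ k
  e-injective = proj₂ (proj₂ (proj₂ E-size))

  E-0 : ∀ {g} → E g → to g zeroV ≡ zeroV
  E-0 {g} g∈E = proj₂ (E≤G₀ g g∈E)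

  E-additive : ∀ {g} → E g → Additive (to g)
  E-additive {g} g∈E = affine⇒additive {g} (G-affine g (proj₁ (E≤G₀ g g∈E))) (E-0 g∈E)

  E-neg : ∀ {g} → E g → ∀ u → to g (f2 ∙ u) ≡ f2 ∙ to g u
  E-neg g∈E = additive-∙ (E-additive g∈E) f2

  fixes0⇒≢0 : ∀ g → to g zeroV ≡ zeroV → ∀ {u} → u ≢ zeroV → to g u ≢ zeroV
  fixes0⇒≢0 g g0 u≢0 gu≡0 = u≢0 (to-injective g (trans gu≡0 (sym g0)))

  M-preserves : ∀ m → Semidirect E m → ∀ x y → x ≢ y → c (to m x) (to m y) ≡ c x y
  M-preserves m m∈M = proj₂ (proj₁ (M-kernel m) m∈M)

  translation∈M : ∀ b → Semidirect E (translation b)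
  translation∈M b = b , idP , id∈ , λ _ → refl

  E⊆M : ∀ {g} → E g → Semidirect E g
  E⊆M {g} g∈E = zeroV , g , g∈E , λ x → sym (+ᵥ-identityʳ (to g x))

  colour : V → Fin 5
  colour = c zeroV

  -- Translations lie in the kernel M, so the colour of a pair depends only on the difference of its
  -- ends.
  c≡colour : ∀ x y → x ≢ y → c x y ≡ colour (y +ᵥ (f2 ∙ x))
  c≡colour x y x≢y = begin
    c x y                                  ≡⟨ sym (M-preserves (translation (f2 ∙ x)) (translation∈M (f2 ∙ x)) x y x≢y) ⟩
    c (x +ᵥ (f2 ∙ x)) (y +ᵥ (f2 ∙ x))      ≡⟨ cong₂ c (identity (X₀ ⊕ f2 ⊙ X₀) 𝟘 (x ∷ [])) refl ⟩
    colour (y +ᵥ (f2 ∙ x))                 ∎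

  E-colour : ∀ {g} → E g → ∀ {u} → u ≢ zeroV → colour (to g u) ≡ colour u
  E-colour {g} g∈E {u} u≢0 =
    trans (cong (λ w → c w (to g u)) (sym (E-0 g∈E))) (M-preserves g (E⊆M g∈E) zeroV u (u≢0 ∘ sym))

  -- Arc-transitivity moves the arc (0, u) to (0, v) by some m in M. As m fixes 0, its translation
  -- part is 0, which leaves an element of E.
  E-transitive : ∀ {u v} → u ≢ zeroV → v ≢ zeroV → colour u ≡ colour v → ∃ λ g → E g × to g u ≡ v
  E-transitive {u} {v} u≢0 v≢0 eq
    with arc-trans (colour u) zeroV u zeroV v (u≢0 ∘ sym , refl) (v≢0 ∘ sym , sym eq)
  ... | m , (b , g , g∈E , m≡g+b) , m0≡0 , mu≡v = g , g∈E , (begin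
    to g u            ≡⟨ sym (+ᵥ-identityʳ _) ⟩
    to g u +ᵥ zeroV   ≡⟨ cong (to g u +ᵥ_) (sym b≡0) ⟩
    to g u +ᵥ b       ≡⟨ sym (m≡g+b u) ⟩
    to m u            ≡⟨ mu≡v ⟩
    v                 ∎)
    where
    b≡0 : b ≡ zeroV
    b≡0 = begin
      b                    ≡⟨ sym (+ᵥ-identityˡ b) ⟩
      zeroV +ᵥ b           ≡⟨ cong (_+ᵥ b) (sym (E-0 g∈E)) ⟩
      to g zeroV +ᵥ b      ≡⟨ sym (m≡g+b zeroV) ⟩
      to m zeroV           ≡⟨ m0≡0 ⟩
      zeroV                ∎

  -- The centre of E is {1, -1}

  id∈Z : Centre E idP
  id∈Z = id∈ , λ _ _ _ → refl

  opaque
    -- The enumeration lists two central elements without saying which one is the identity; z is the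
    -- other one.
    Z-generator : ∃ λ z → Centre E z × ¬ (z ≈ₚ idP) × (∀ g → Centre E g → (g ≈ₚ idP) ⊎ (g ≈ₚ z))
    Z-generator with proj₁ (proj₂ (proj₂ E-extraspecial))
    ... | (z₀ ∷ z₁ ∷ []) , z∈Z , z-surjective , z-injective with z-surjective idP id∈Z
    ... | 0F , id≈z₀ = z₁ , z∈Z 1F
      , (λ z₁≈id → Fin.0≢1+n (z-injective 0F 1F (λ x → trans (sym (id≈z₀ x)) (sym (z₁≈id x)))))
      , λ g g∈Z → classify g (z-surjective g g∈Z)
      where
      classify : ∀ g → ∃ (λ k → g ≈ₚ lookup (z₀ ∷ z₁ ∷ []) k) → (g ≈ₚ idP) ⊎ (g ≈ₚ z₁)
      classify g (0F , eq) = inj₁ λ x → trans (eq x) (sym (id≈z₀ x))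
      classify g (1F , eq) = inj₂ eq
    ... | 1F , id≈z₁ = z₀ , z∈Z 0F
      , (λ z₀≈id → Fin.0≢1+n (z-injective 0F 1F (λ x → trans (z₀≈id x) (id≈z₁ x))))
      , λ g g∈Z → classify g (z-surjective g g∈Z)
      where
      classify : ∀ g → ∃ (λ k → g ≈ₚ lookup (z₀ ∷ z₁ ∷ []) k) → (g ≈ₚ idP) ⊎ (g ≈ₚ z₀)
      classify g (0F , eq) = inj₂ eq
      classify g (1F , eq) = inj₁ λ x → trans (eq x) (sym (id≈z₁ x))

  z : Perm
  z = proj₁ Z-generator

  z∈Z : Centre E z
  z∈Z = proj₁ (proj₂ Z-generator)

  z≉id : ¬ (z ≈ₚ idP)
  z≉id = proj₁ (proj₂ (proj₂ Z-generator))

  Z-cases : ∀ g → Centre E g → (g ≈ₚ idP) ⊎ (g ≈ₚ z)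
  Z-cases = proj₂ (proj₂ (proj₂ Z-generator))

  stab⁻¹ : ∀ {g} → Stab0 G g → Stab0 G (g ⁻¹ₚ)
  stab⁻¹ {g} (g∈G , g0) = IsSubgroup.⁻¹∈ G-subgroup g∈G , trans (cong (from g) (sym g0)) (from-to g zeroV)

  -- The centre is characteristic in the normal subgroup E: to commute the conjugate of z with h,
  -- conjugate h back into E, where z commutes with it.
  conjugate-central : ∀ g → Stab0 G g → Centre E ((g ∘ₚ z) ∘ₚ (g ⁻¹ₚ))
  conjugate-central g g∈G₀ = E-normal g z g∈G₀ (proj₁ z∈Z) , λ h h∈E x → begin
    to g (to z (from g (to h x)))
      ≡⟨ cong (to g ∘ to z ∘ from g ∘ to h) (sym (to-from g x)) ⟩
    to g (to z (from g (to h (to g (from g x)))))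
      ≡⟨ cong (to g) (proj₂ z∈Z (((g ⁻¹ₚ) ∘ₚ h) ∘ₚ ((g ⁻¹ₚ) ⁻¹ₚ)) (E-normal (g ⁻¹ₚ) h (stab⁻¹ {g} g∈G₀) h∈E) (from g x)) ⟩
    to g (from g (to h (to g (to z (from g x)))))
      ≡⟨ to-from g _ ⟩
    to h (to g (to z (from g x))) ∎

  -- The conjugate of z by g is central and nontrivial, hence z itself.
  z-commutes-G₀ : ∀ g → Stab0 G g → Commute g z
  z-commutes-G₀ g g∈G₀ x with Z-cases _ (conjugate-central g g∈G₀)
  ... | inj₂ gzg⁻¹≈z = trans (cong (to g ∘ to z) (sym (from-to g x))) (gzg⁻¹≈z (to g x))
  ... | inj₁ gzg⁻¹≈id = ⊥-elim (z≉id λ y → to-injective g (begin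
    to g (to z y)                    ≡⟨ cong (to g ∘ to z) (sym (from-to g y)) ⟩
    to g (to z (from g (to g y)))    ≡⟨ gzg⁻¹≈id (to g y) ⟩
    to g y                           ∎))

  -- The fixed space of z is invariant under G₀, which is transitive on
  -- nonzero vectors.
  z-fixes-only-0 : ∀ {v} → to z v ≡ v → v ≡ zeroV
  z-fixes-only-0 {v} zv≡v with v ≟ᵥ zeroV
  ... | yes v≡0 = v≡0
  ... | no v≢0 = ⊥-elim (z≉id fixed)
    where
    fixed : ∀ u → to z u ≡ u
    fixed u with u ≟ᵥ zeroV
    ... | yes refl = E-0 (proj₁ z∈Z)
    ... | no u≢0 with G-2trans zeroV v zeroV u (v≢0 ∘ sym) (u≢0 ∘ sym)
    ... | g , g∈G , g0 , gv≡u = begin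
      to z u          ≡⟨ cong (to z) (sym gv≡u) ⟩
      to z (to g v)   ≡⟨ sym (z-commutes-G₀ g (g∈G , g0) v) ⟩
      to g (to z v)   ≡⟨ cong (to g) zv≡v ⟩
      to g v          ≡⟨ gv≡u ⟩
      u               ∎

  z∘z∈Z : Centre E (z ∘ₚ z)
  z∘z∈Z = ∘∈ (proj₁ z∈Z) (proj₁ z∈Z) , λ h h∈E x →
    trans (cong (to z) (proj₂ z∈Z h h∈E x)) (proj₂ z∈Z h h∈E (to z x))

  z-involutive : ∀ x → to z (to z x) ≡ x
  z-involutive with Z-cases _ z∘z∈Z
  ... | inj₁ z²≈id = z²≈id
  ... | inj₂ z²≈z = ⊥-elim (z≉id λ x → to-injective z (z²≈z x))

  -- The vector v + z v is fixed by z and therefore zero.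
  z≡- : ∀ v → to z v ≡ f2 ∙ v
  z≡- v = u+v≡0⇒v≡-u (z-fixes-only-0 (begin
    to z (v +ᵥ to z v)         ≡⟨ E-additive (proj₁ z∈Z) v (to z v) ⟩
    to z v +ᵥ to z (to z v)    ≡⟨ cong (to z v +ᵥ_) (z-involutive v) ⟩
    to z v +ᵥ v                ≡⟨ +ᵥ-comm _ _ ⟩
    v +ᵥ to z v                ∎))

  Z-±1 : ∀ g → Centre E g → (∀ x → to g x ≡ x) ⊎ (∀ x → to g x ≡ f2 ∙ x)
  Z-±1 g g∈Z with Z-cases g g∈Z
  ... | inj₁ g≈id = inj₁ g≈id
  ... | inj₂ g≈z = inj₂ λ x → trans (g≈z x) (z≡- x)

  -- Commutators of E are central, hence ±1, and h g [g, h] = g h.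
  commute⊎anticommute : ∀ g h → E g → E h → Commute g h ⊎ Anticommute g h
  commute⊎anticommute g h g∈E h∈E
    with Z-±1 _ (proj₂ (proj₂ (proj₂ (proj₂ E-extraspecial))) g h g∈E h∈E)
  ... | inj₁ [g,h]≈id = inj₁ λ x → trans (sym (unwind x)) (cong (to h ∘ to g) ([g,h]≈id x))
    where
    unwind : ∀ x → to h (to g (to (comm g h) x)) ≡ to g (to h x)
    unwind x = trans (cong (to h) (to-from g _)) (to-from h _)
  ... | inj₂ [g,h]≈- = inj₂ λ x → begin
    to g (to h x)                      ≡⟨ sym (trans (cong (to h) (to-from g _)) (to-from h _)) ⟩
    to h (to g (to (comm g h) x))      ≡⟨ cong (to h ∘ to g) ([g,h]≈- x) ⟩
    to h (to g (f2 ∙ x))               ≡⟨ cong (to h) (E-neg g∈E x) ⟩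
    to h (f2 ∙ to g x)                 ≡⟨ E-neg h∈E (to g x) ⟩
    f2 ∙ to h (to g x)                 ∎

  -- The involution attached to one colour

  record Reflection (i : Fin 5) : Set where
    field
      t           : Perm
      t∈E         : E t
      involutive  : ∀ x → to t (to t x) ≡ x
      v           : V
      v≢0         : v ≢ zeroV
      tv≡v        : to t v ≡ v
      eigen⇒colour : ∀ {u} → u ≢ zeroV → t ±Eigen u → colour u ≡ i

  module Construction (i : Fin 5) where

    φ : Bij V (Fin 9 × Fin 9)
    φ = proj₁ (factors-H92 i)

    adj⇒ham : ∀ x y → Adj c i x y → HamAdj (to φ x) (to φ y)
    adj⇒ham x y = proj₁ (proj₂ (factors-H92 i) x y)

    ham⇒adj : ∀ x y → HamAdj (to φ x) (to φ y) → Adj c i x y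
    ham⇒adj x y = proj₂ (proj₂ (factors-H92 i) x y)

    a₀ b₀ : Fin 9
    a₀ = proj₁ (to φ zeroV)
    b₀ = proj₂ (to φ zeroV)

    -- The grid row of the vertex 0: a copy of K_9 in the factor that contains 0.
    row : Fin 9 → V
    row b = from φ (a₀ , b)

    row-injective : ∀ {b b'} → row b ≡ row b' → b ≡ b'
    row-injective eq = cong proj₂ (from-injective φ eq)

    row-adj : ∀ {b b'} → b ≢ b' → Adj c i (row b) (row b')
    row-adj {b} {b'} b≢b' = ham⇒adj (row b) (row b')
      (inj₁ (trans (cong proj₁ (to-from φ _)) (sym (cong proj₁ (to-from φ _)))
            , λ eq → b≢b' (trans (sym (cong proj₂ (to-from φ _))) (trans eq (cong proj₂ (to-from φ _))))))

    row-b₀ : row b₀ ≡ zeroV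
    row-b₀ = from-to φ zeroV

    b₁ : Fin 9
    b₁ = proj₁ other
      where
      other : ∃ λ b → b ≢ b₀
      other with b₀
      ... | zero = suc zero , λ ()
      ... | suc _ = zero , λ ()

    b₁≢b₀ : b₁ ≢ b₀
    b₁≢b₀ with b₀
    ... | zero = λ ()
    ... | suc _ = λ ()

    row≢0 : ∀ {b} → b ≢ b₀ → row b ≢ zeroV
    row≢0 b≢b₀ eq = b≢b₀ (row-injective (trans eq (sym row-b₀)))

    row-colour : ∀ {b} → b ≢ b₀ → colour (row b) ≡ i
    row-colour b≢b₀ = trans (cong₂ c (sym row-b₀) refl) (proj₂ (row-adj (b≢b₀ ∘ sym)))

    v : V
    v = row b₁

    v≢0 : v ≢ zeroV
    v≢0 = row≢0 b₁≢b₀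

    orbit-ham : ∀ k → HamAdj (to φ zeroV) (to φ (to (e k) v))
    orbit-ham k = adj⇒ham _ _
      ( (λ eq → fixes0⇒≢0 (e k) (E-0 (e∈E k)) v≢0 (sym eq))
      , trans (E-colour (e∈E k) v≢0) (row-colour b₁≢b₀))

    -- The row and the column of a vertex give 18 codes, fewer than |E| = 32.
    code : ∀ {p q} → HamAdj p q → Fin 18
    code {q = a , b} (inj₁ _) = join 9 9 (inj₁ b)
    code {q = a , b} (inj₂ _) = join 9 9 (inj₂ a)

    -- A neighbour of p shares one coordinate with p, so the tag and the other coordinate determine
    -- it.
    code-injective : ∀ {p q q'} (h : HamAdj p q) (h' : HamAdj p q') → code h ≡ code h' → q ≡ q'
    code-injective (inj₁ (refl , _)) (inj₁ (refl , _)) eq =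
      cong (_ ,_) (Fin.↑ˡ-injective 9 _ _ eq)
    code-injective (inj₂ (_ , refl)) (inj₂ (_ , refl)) eq =
      cong (_, _) (Fin.↑ʳ-injective 9 _ _ eq)
    code-injective {q = _ , b} {q' = a' , _} (inj₁ _) (inj₂ _) eq
      with trans (sym (Fin.splitAt-join 9 9 (inj₁ b))) (trans (cong (splitAt 9) eq) (Fin.splitAt-join 9 9 (inj₂ a')))
    ... | ()
    code-injective {q = a , _} {q' = _ , b'} (inj₂ _) (inj₁ _) eq
      with trans (sym (Fin.splitAt-join 9 9 (inj₂ a))) (trans (cong (splitAt 9) eq) (Fin.splitAt-join 9 9 (inj₁ b')))
    ... | ()

    opaque
      stabiliser : ∃ λ t → E t × to t v ≡ v × ¬ (t ≈ₚ idP)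
      -- The inequality is 18 < 32. If two distinct elements of E agree at v, their quotient fixes v
      -- and is not the identity.
      stabiliser = from-collision (pigeonhole (ℕ.m≤m+n 19 13) (λ k → code (orbit-ham k)))
        where
        from-collision : (∃ λ j → ∃ λ k → j Fin.< k × code (orbit-ham j) ≡ code (orbit-ham k)) →
                         ∃ λ t → E t × to t v ≡ v × ¬ (t ≈ₚ idP)
        from-collision (j , k , j<k , eq) = (e j ⁻¹ₚ) ∘ₚ e k , ∘∈ (⁻¹∈ (e∈E j)) (e∈E k)
          , trans (cong (from (e j)) (sym eⱼv≡eₖv)) (from-to (e j) v)
          , λ t≈id → <⇒≢ j<k (e-injective j k λ x →
              trans (cong (to (e j)) (sym (t≈id x))) (to-from (e j) _))
          where
          eⱼv≡eₖv : to (e j) v ≡ to (e k) v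
          eⱼv≡eₖv = to-injective φ (code-injective (orbit-ham j) (orbit-ham k) eq)

    t : Perm
    t = proj₁ stabiliser

    t∈E : E t
    t∈E = proj₁ (proj₂ stabiliser)

    tv≡v : to t v ≡ v
    tv≡v = proj₁ (proj₂ (proj₂ stabiliser))

    t≉id : ¬ (t ≈ₚ idP)
    t≉id = proj₂ (proj₂ (proj₂ stabiliser))

    -- Squares in E are central, so t² = ±1, and t² fixes the nonzero vector v.
    involutive : ∀ x → to t (to t x) ≡ x
    involutive with Z-±1 _ (proj₁ (proj₂ (proj₂ (proj₂ E-extraspecial))) t t∈E)
    ... | inj₁ t²≈id = t²≈id
    ... | inj₂ t²≈- = ⊥-elim (v≢0 (u≡-u⇒u≡0
      (trans (sym (trans (cong (to t) tv≡v) tv≡v)) (t²≈- v))))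

    -- Moving t past g costs at most a sign: t g v = ± g t v = ± g v.
    t-orbit : ∀ {g} → E g → t ±Eigen (to g v)
    t-orbit {g} g∈E with commute⊎anticommute t g t∈E g∈E
    ... | inj₁ tg≡gt = inj₁ (trans (tg≡gt v) (cong (to g) tv≡v))
    ... | inj₂ tg≡-gt = inj₂ (trans (tg≡-gt v) (cong (λ w → f2 ∙ to g w) tv≡v))

    -- The nonzero vectors of colour i form a single E-orbit, that of v.
    colour⇒eigen : ∀ {u} → u ≢ zeroV → colour u ≡ i → t ±Eigen u
    colour⇒eigen u≢0 colour≡i
      with E-transitive v≢0 u≢0 (trans (row-colour b₁≢b₀) (sym colour≡i))
    ... | g , g∈E , refl = t-orbit g∈E

    opaque
      -- Otherwise t would be central, so t = ±1; but t is not the identity, and -1 does not fix v.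
      swap : ∃ λ g → E g × Anticommute t g
      swap = [ central⇒ , (λ (k , tg≡-gt) → e k , e∈E k , tg≡-gt) ]′
        (every⊎some λ k → commute⊎anticommute t (e k) t∈E (e∈E k))
        where
        central⇒ : (∀ k → Commute t (e k)) → ∃ λ g → E g × Anticommute t g
        central⇒ central with Z-±1 t (t∈E , λ h h∈E x → t-commutes h (e-surjective h h∈E) x)
          where
          t-commutes : ∀ h → ∃ (λ k → h ≈ₚ e k) → Commute t h
          t-commutes h (k , h≈eₖ) x =
            trans (cong (to t) (h≈eₖ x)) (trans (central k x) (sym (h≈eₖ (to t x))))
        ... | inj₁ t≈id = ⊥-elim (t≉id t≈id)
        ... | inj₂ t≈- = ⊥-elim (v≢0 (u≡-u⇒u≡0 (trans (sym tv≡v) (t≈- v))))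

    g : Perm
    g = proj₁ swap

    g∈E : E g
    g∈E = proj₁ (proj₂ swap)

    tg≡-gt : Anticommute t g
    tg≡-gt = proj₂ (proj₂ swap)

    t-+ : Additive (to t)
    t-+ = E-additive t∈E

    -- w and v lie in one eigenspace, since otherwise w − v would not be an eigenvector.
    row-fixed : ∀ b → to t (row b) ≡ row b
    row-fixed b with b Fin.≟ b₀ | b Fin.≟ b₁
    ... | yes refl | _ = trans (cong (to t) row-b₀) (trans (E-0 t∈E) (sym row-b₀))
    ... | no _ | yes refl = tv≡v
    ... | no b≢b₀ | no b≢b₁ with colour⇒eigen (row≢0 b≢b₀) (row-colour b≢b₀)
    ...   | inj₁ tw≡w = tw≡w
    ...   | inj₂ tw≡-w = ⊥-elim (mixed (colour⇒eigen d≢0 (trans (sym (c≡colour v w (proj₁ v~w))) (proj₂ v~w))))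
      where
      w d : V
      w = row b
      d = w +ᵥ (f2 ∙ v)
      v~w : Adj c i v w
      v~w = row-adj (b≢b₁ ∘ sym)
      d≢0 : d ≢ zeroV
      d≢0 d≡0 = proj₁ v~w (sym (u-v≡0⇒u≡v d≡0))
      td : to t d ≡ (f2 ∙ w) +ᵥ (f2 ∙ v)
      td = trans (additive-sub t-+ w v) (cong₂ (λ p q → p +ᵥ (f2 ∙ q)) tw≡-w tv≡v)
      mixed : ¬ (t ±Eigen d)
      mixed (inj₁ td≡d) = row≢0 b≢b₀ (u≡-u⇒u≡0 (begin
        w                                          ≡⟨ identity X₀ (f2 ⊙ ((f2 ⊙ X₀ ⊕ f2 ⊙ X₁) ⊕ X₁)) (w ∷ v ∷ []) ⟩
        f2 ∙ (((f2 ∙ w) +ᵥ (f2 ∙ v)) +ᵥ v)         ≡⟨ cong (λ p → f2 ∙ (p +ᵥ v)) (trans (sym td) td≡d) ⟩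
        f2 ∙ ((w +ᵥ (f2 ∙ v)) +ᵥ v)                ≡⟨ identity (f2 ⊙ ((X₀ ⊕ f2 ⊙ X₁) ⊕ X₁)) (f2 ⊙ X₀) (w ∷ v ∷ []) ⟩
        f2 ∙ w                                     ∎))
      mixed (inj₂ td≡-d) = v≢0 (u≡-u⇒u≡0 (begin
        v                                          ≡⟨ identity X₁ (f2 ⊙ ((f2 ⊙ X₀ ⊕ f2 ⊙ X₁) ⊕ X₀)) (w ∷ v ∷ []) ⟩
        f2 ∙ (((f2 ∙ w) +ᵥ (f2 ∙ v)) +ᵥ w)         ≡⟨ cong (λ p → f2 ∙ (p +ᵥ w)) (trans (sym td) td≡-d) ⟩
        f2 ∙ ((f2 ∙ (w +ᵥ (f2 ∙ v))) +ᵥ w)         ≡⟨ identity (f2 ⊙ (f2 ⊙ (X₀ ⊕ f2 ⊙ X₁) ⊕ X₀)) (f2 ⊙ X₁) (w ∷ v ∷ []) ⟩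
        f2 ∙ v                                     ∎))

    -- t ∘ g = −g ∘ t makes g map the 9 row vectors, which t fixes, to
    -- vectors negated by t; the 81 sums r + g r' then exhaust V.
    sumOf : Fin 9 × Fin 9 → V
    sumOf (b , b') = row b +ᵥ to g (row b')

    t-g-row : ∀ b → to t (to g (row b)) ≡ f2 ∙ to g (row b)
    t-g-row b = trans (tg≡-gt (row b)) (cong (λ w → f2 ∙ to g w) (row-fixed b))

    t-sumOf : ∀ p → to t (sumOf p) ≡ row (proj₁ p) +ᵥ (f2 ∙ to g (row (proj₂ p)))
    t-sumOf (b , b') = trans (t-+ _ _) (cong₂ _+ᵥ_ (row-fixed b) (t-g-row b'))

    -- In GF(3) the inverse of 2 is -1, so -(1 + t) and -(1 - t) are the projections onto the two
    -- eigenspaces of t.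
    pos-part : ∀ p → row (proj₁ p) ≡ f2 ∙ (sumOf p +ᵥ to t (sumOf p))
    pos-part p = trans (identity X₀ (f2 ⊙ ((X₀ ⊕ X₁) ⊕ (X₀ ⊕ f2 ⊙ X₁))) (row (proj₁ p) ∷ to g (row (proj₂ p)) ∷ []))
      (cong (λ w → f2 ∙ (sumOf p +ᵥ w)) (sym (t-sumOf p)))

    neg-part : ∀ p → to g (row (proj₂ p)) ≡ f2 ∙ (sumOf p +ᵥ (f2 ∙ to t (sumOf p)))
    neg-part p = trans (identity X₁ (f2 ⊙ ((X₀ ⊕ X₁) ⊕ f2 ⊙ (X₀ ⊕ f2 ⊙ X₁))) (row (proj₁ p) ∷ to g (row (proj₂ p)) ∷ []))
      (cong (λ w → f2 ∙ (sumOf p +ᵥ (f2 ∙ w))) (sym (t-sumOf p)))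

    sumOf-injective : ∀ {p q} → sumOf p ≡ sumOf q → p ≡ q
    sumOf-injective {p} {q} eq = cong₂ _,_
      (row-injective (trans (pos-part p) (trans (cong (λ w → f2 ∙ (w +ᵥ to t w)) eq) (sym (pos-part q)))))
      (row-injective (to-injective g (trans (neg-part p)
        (trans (cong (λ w → f2 ∙ (w +ᵥ (f2 ∙ to t w))) eq) (sym (neg-part q))))))

    opaque
      sumOf-surjective : ∀ w → ∃ λ p → sumOf p ≡ w
      sumOf-surjective w =
        Product.map (to φ) id (injective⇒surjective (φ ⨾ combineᵇ 9 9) (sumOf ∘ to φ) (to-injective φ ∘ sumOf-injective) w)

    -- A fixed vector is its own positive component, and positive components of sums lie in the row.
    fixed⇒row : ∀ {w} → to t w ≡ w → ∃ λ b → row b ≡ w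
    fixed⇒row {w} tw≡w with sumOf-surjective w
    ... | p@(b , b') , refl = b , (begin
      row b                              ≡⟨ pos-part p ⟩
      f2 ∙ (sumOf p +ᵥ to t (sumOf p))   ≡⟨ cong (λ u → f2 ∙ (sumOf p +ᵥ u)) tw≡w ⟩
      f2 ∙ (sumOf p +ᵥ sumOf p)          ≡⟨ identity (f2 ⊙ (X₀ ⊕ X₀)) X₀ (sumOf p ∷ []) ⟩
      sumOf p                            ∎)

    fixed⇒colour : ∀ {w} → w ≢ zeroV → to t w ≡ w → colour w ≡ i
    fixed⇒colour w≢0 tw≡w with fixed⇒row tw≡w
    ... | b , refl = row-colour λ { refl → w≢0 row-b₀ }

    -- The map g carries negated vectors to fixed ones and preserves colours, so the second
    -- eigenspace has the colour of the first.
    eigen⇒colour : ∀ {w} → w ≢ zeroV → t ±Eigen w → colour w ≡ i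
    eigen⇒colour w≢0 (inj₁ tw≡w) = fixed⇒colour w≢0 tw≡w
    eigen⇒colour {w} w≢0 (inj₂ tw≡-w) = trans (sym (E-colour g∈E w≢0))
      (fixed⇒colour (fixes0⇒≢0 g (E-0 g∈E) w≢0) (begin
        to t (to g w)        ≡⟨ tg≡-gt w ⟩
        f2 ∙ to g (to t w)   ≡⟨ cong (λ u → f2 ∙ to g u) tw≡-w ⟩
        f2 ∙ to g (f2 ∙ w)   ≡⟨ cong (f2 ∙_) (E-neg g∈E w) ⟩
        f2 ∙ (f2 ∙ to g w)   ≡⟨ -‿involutive _ ⟩
        to g w               ∎))

    opaque
      reflection : Reflection i
      reflection = record
        { t = t ; t∈E = t∈E ; involutive = involutive ; v = v ; v≢0 = v≢0 ; tv≡v = tv≡v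
        ; eigen⇒colour = eigen⇒colour }

  module _ (i : Fin 5) where
    open Reflection (Construction.reflection i) public

  -- If the two involutions commuted, w would be fixed by both and thus have both colours. Should w
  -- vanish, then v i itself is negated by `t j` and plays the same part.
  anticommute : ∀ i j → i ≢ j → Anticommute (t i) (t j)
  anticommute i j i≢j with commute⊎anticommute (t i) (t j) (t∈E i) (t∈E j)
  ... | inj₂ anti = anti
  ... | inj₁ commute = ⊥-elim (i≢j common)
    where
    w : V
    w = v i +ᵥ to (t j) (v i)
    common : i ≡ j
    common with w ≟ᵥ zeroV
    ... | yes w≡0 = trans (sym (eigen⇒colour i (v≢0 i) (inj₁ (tv≡v i))))
      (eigen⇒colour j (v≢0 i) (inj₂ (u+v≡0⇒v≡-u w≡0)))
    ... | no w≢0 = trans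
      (sym (eigen⇒colour i w≢0 (inj₁ (trans (E-additive (t∈E i) _ _)
        (cong₂ _+ᵥ_ (tv≡v i) (trans (commute (v i)) (cong (to (t j)) (tv≡v i))))))))
      (eigen⇒colour j w≢0 (inj₁ (begin
        to (t j) w                              ≡⟨ E-additive (t∈E j) _ _ ⟩
        to (t j) (v i) +ᵥ to (t j) (to (t j) (v i)) ≡⟨ cong (to (t j) (v i) +ᵥ_) (involutive j (v i)) ⟩
        to (t j) (v i) +ᵥ v i                   ≡⟨ +ᵥ-comm _ _ ⟩
        w                                       ∎)))

-- Coordinates

_*ₛ_ : F3 → F9 → F9
s *ₛ (a , b) = (s *₃ a) , (s *₃ b)

-- Multiplication by i in GF(9), which is the action of J in coordinates.
rot : F9 → F9
rot (a , b) = (-₃ b) , a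

-- All that the coordinates take from the group, as plain maps on V; `enumeration` supplies the
-- finiteness by which injectivity of a self-map gives surjectivity.
record Frame (colour : V → Fin 5) : Set where
  field
    t            : Fin 5 → V → V
    additive     : ∀ i → Additive (t i)
    involutive   : ∀ i u → t i (t i u) ≡ u
    anticommute  : ∀ i j → i ≢ j → ∀ u → t i (t j u) ≡ f2 ∙ t j (t i u)
    eigen⇒colour : ∀ i {u} → u ≢ zeroV → (t i u ≡ u) ⊎ (t i u ≡ f2 ∙ u) → colour u ≡ i
    x            : V
    x≢0          : x ≢ zeroV
    t₀x≡x        : t 0F x ≡ x
    enumeration  : Bij V (Fin 81)

-- Here the scalars are variables too, so the comparison of expressions is tabulated over all
-- scalars, as in several proofs below.
∙-distribʳ : ∀ p q u → (p +₃ q) ∙ u ≡ (p ∙ u) +ᵥ (q ∙ u)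
∙-distribʳ p q u = ⟦⟧-cong (lhs p q) (rhs p q) (table p q) (u ∷ [])
  where
  lhs rhs : F3 → F3 → Expr 1
  lhs p q = (p +₃ q) ⊙ X₀
  rhs p q = p ⊙ X₀ ⊕ q ⊙ X₀
  opaque
    table : ∀ p q → lhs p q ≈ₑ rhs p q
    table = from-yes (all₃? λ p → all₃? λ q → lhs p q ≈ₑ? rhs p q)

+ᵥ-interchange : ∀ u v u' v' → (u +ᵥ v) +ᵥ (u' +ᵥ v') ≡ (u +ᵥ u') +ᵥ (v +ᵥ v')
+ᵥ-interchange u v u' v' =
  identity ((X₀ ⊕ X₁) ⊕ (X₂ ⊕ X₃)) ((X₀ ⊕ X₂) ⊕ (X₁ ⊕ X₃)) (u ∷ v ∷ u' ∷ v' ∷ [])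

module Coordinates (colour : V → Fin 5) (F : Frame colour) where
  open Frame F
  open ≡-Reasoning

  b : V → V
  b = t 1F

  neg : ∀ i u → t i (f2 ∙ u) ≡ f2 ∙ t i u
  neg i = additive-∙ (additive i) f2

  t-injective : ∀ i {u v} → t i u ≡ t i v → u ≡ v
  t-injective i {u} {v} eq = trans (sym (involutive i u)) (trans (cong (t i) eq) (involutive i v))

  J : V → V
  J u = b (t 2F u)

  J-additive : Additive J
  J-additive u v = trans (cong b (additive 2F u v)) (additive 1F _ _)

  -- Anticommuting with both factors of J produces two signs, which cancel.
  anticommute-J : ∀ i → i ≢ 1F → i ≢ 2F → ∀ u → t i (J u) ≡ J (t i u)
  anticommute-J i i≢1 i≢2 u = begin
    t i (b (t 2F u))            ≡⟨ anticommute i 1F i≢1 _ ⟩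
    f2 ∙ b (t i (t 2F u))       ≡⟨ cong (λ w → f2 ∙ b w) (anticommute i 2F i≢2 u) ⟩
    f2 ∙ b (f2 ∙ t 2F (t i u))  ≡⟨ cong (f2 ∙_) (neg 1F _) ⟩
    f2 ∙ (f2 ∙ J (t i u))       ≡⟨ -‿involutive _ ⟩
    J (t i u)                   ∎

  J∘b : ∀ u → J (b u) ≡ f2 ∙ b (J u)
  J∘b u = trans (cong b (anticommute 2F 1F (λ ()) u)) (neg 1F _)

  -- The product of two anticommuting involutions squares to -1.
  J∘J : ∀ u → J (J u) ≡ f2 ∙ u
  J∘J u = begin
    J (b (t 2F u))                ≡⟨ J∘b (t 2F u) ⟩
    f2 ∙ b (b (t 2F (t 2F u)))    ≡⟨ cong (f2 ∙_) (involutive 1F _) ⟩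
    f2 ∙ t 2F (t 2F u)            ≡⟨ cong (f2 ∙_) (involutive 2F u) ⟩
    f2 ∙ u                        ∎

  ℓ : F9 → V
  ℓ (p , q) = (p ∙ x) +ᵥ (q ∙ J x)

  ℓ-+ : ∀ X Y → ℓ (X +₉ Y) ≡ ℓ X +ᵥ ℓ Y
  ℓ-+ (p , q) (p' , q') = trans (cong₂ _+ᵥ_ (∙-distribʳ p p' x) (∙-distribʳ q q' (J x))) (+ᵥ-interchange _ _ _ _)

  ℓ-*ₛ : ∀ s X → ℓ (s *ₛ X) ≡ s ∙ ℓ X
  ℓ-*ₛ s (p , q) = ⟦⟧-cong (lhs s p q) (rhs s p q) (table s p q) (x ∷ J x ∷ [])
    where
    lhs rhs : F3 → F3 → F3 → Expr 2
    lhs s p q = (s *₃ p) ⊙ X₀ ⊕ (s *₃ q) ⊙ X₁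
    rhs s p q = s ⊙ (p ⊙ X₀ ⊕ q ⊙ X₁)
    opaque
      table : ∀ s p q → lhs s p q ≈ₑ rhs s p q
      table = from-yes (all₃? λ s → all₃? λ p → all₃? λ q → lhs s p q ≈ₑ? rhs s p q)

  ℓ-neg : ∀ X → ℓ (-₉ X) ≡ f2 ∙ ℓ X
  ℓ-neg = ℓ-*ₛ f2

  ℓ-1 : ℓ 1₉ ≡ x
  ℓ-1 = identity (f1 ⊙ X₀ ⊕ f0 ⊙ X₁) X₀ (x ∷ J x ∷ [])

  ℓ-0 : ℓ 0₉ ≡ zeroV
  ℓ-0 = identity (f0 ⊙ X₀ ⊕ f0 ⊙ X₁) 𝟘 (x ∷ J x ∷ [])

  additive-combination : ∀ {f} → Additive f → ∀ p q u v → f ((p ∙ u) +ᵥ (q ∙ v)) ≡ (p ∙ f u) +ᵥ (q ∙ f v)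
  additive-combination f-+ p q u v = trans (f-+ _ _) (cong₂ _+ᵥ_ (additive-∙ f-+ p u) (additive-∙ f-+ q v))

  J-ℓ : ∀ X → J (ℓ X) ≡ ℓ (rot X)
  J-ℓ (p , q) = begin
    J (ℓ (p , q))                           ≡⟨ additive-combination J-additive p q x (J x) ⟩
    (p ∙ J x) +ᵥ (q ∙ J (J x))              ≡⟨ cong (λ w → (p ∙ J x) +ᵥ (q ∙ w)) (J∘J x) ⟩
    (p ∙ J x) +ᵥ (q ∙ (f2 ∙ x))
      ≡⟨ ⟦⟧-cong (lhs p q) (rhs p q) (table p q) (x ∷ J x ∷ []) ⟩
    ℓ (rot (p , q))                         ∎
    where
    lhs rhs : F3 → F3 → Expr 2
    lhs p q = p ⊙ X₁ ⊕ q ⊙ f2 ⊙ X₀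
    rhs p q = (-₃ q) ⊙ X₀ ⊕ p ⊙ X₁
    opaque
      table : ∀ p q → lhs p q ≈ₑ rhs p q
      table = from-yes (all₃? λ p → all₃? λ q → lhs p q ≈ₑ? rhs p q)

  t₀-ℓ : ∀ X → t 0F (ℓ X) ≡ ℓ X
  t₀-ℓ (p , q) = trans (additive-combination (additive 0F) p q x (J x))
    (cong₂ (λ u v → (p ∙ u) +ᵥ (q ∙ v)) t₀x≡x
      (trans (anticommute-J 0F (λ ()) (λ ()) x) (cong J t₀x≡x)))

  t₀-bℓ : ∀ X → t 0F (b (ℓ X)) ≡ f2 ∙ b (ℓ X)
  t₀-bℓ X = trans (anticommute 0F 1F (λ ()) (ℓ X)) (cong (λ w → f2 ∙ b w) (t₀-ℓ X))

  -- (p² + q²) x = p ℓ(p, q) − q J ℓ(p, q)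
  ℓ≡0⇒≡0 : ∀ X → ℓ X ≡ zeroV → X ≡ 0₉
  ℓ≡0⇒≡0 X@(p , q) ℓX≡0 = anisotropic p q norm∙x≡0
    where
    lhs rhs : F3 → F3 → Expr 2
    lhs p q = norm (p , q) ⊙ X₀
    rhs p q = p ⊙ (p ⊙ X₀ ⊕ q ⊙ X₁) ⊕ (-₃ q) ⊙ ((-₃ q) ⊙ X₀ ⊕ p ⊙ X₁)
    opaque
      table : ∀ p q → lhs p q ≈ₑ rhs p q
      table = from-yes (all₃? λ p → all₃? λ q → lhs p q ≈ₑ? rhs p q)
    norm∙x≡0 : norm X ∙ x ≡ zeroV
    norm∙x≡0 = begin
      norm X ∙ x                                ≡⟨ ⟦⟧-cong (lhs p q) (rhs p q) (table p q) (x ∷ J x ∷ []) ⟩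
      (p ∙ ℓ X) +ᵥ ((-₃ q) ∙ ℓ (rot X))         ≡⟨ cong (λ w → (p ∙ ℓ X) +ᵥ ((-₃ q) ∙ w)) (sym (J-ℓ X)) ⟩
      (p ∙ ℓ X) +ᵥ ((-₃ q) ∙ J (ℓ X))           ≡⟨ cong (λ w → (p ∙ w) +ᵥ ((-₃ q) ∙ J w)) ℓX≡0 ⟩
      (p ∙ zeroV) +ᵥ ((-₃ q) ∙ J zeroV)         ≡⟨ cong (λ w → (p ∙ zeroV) +ᵥ ((-₃ q) ∙ w)) (additive-0 J-additive) ⟩
      (p ∙ zeroV) +ᵥ ((-₃ q) ∙ zeroV)           ≡⟨ ⟦⟧-cong (p ⊙ 𝟘 ⊕ (-₃ q) ⊙ 𝟘) 𝟘 (table₀ p q) (x ∷ []) ⟩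
      zeroV                                     ∎
      where
      opaque
        table₀ : ∀ p q → _≈ₑ_ {1} (p ⊙ 𝟘 ⊕ (-₃ q) ⊙ 𝟘) 𝟘
        table₀ = from-yes (all₃? λ p → all₃? λ q → _≈ₑ?_ {1} (p ⊙ 𝟘 ⊕ (-₃ q) ⊙ 𝟘) 𝟘)
    x-torsion : ∀ s → s ≢ f0 → s ∙ x ≢ zeroV
    x-torsion f0 s≢0 _ = s≢0 refl
    x-torsion f1 _ eq = x≢0 (trans (identity X₀ (f1 ⊙ X₀) (x ∷ [])) eq)
    x-torsion f2 _ eq = x≢0 (trans (-‿selfInverse (sym eq)) (identity (f2 ⊙ 𝟘) 𝟘 (x ∷ [])))
    opaque
      -- The form p² + q² is anisotropic because -1 is not a square in GF(3).
      norm-nonzero : ∀ X → norm X ≡ f0 → X ≡ 0₉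
      norm-nonzero = from-yes (all₉? λ X → (norm X ≟₃ f0) →-dec (X ≟₉ 0₉))
    anisotropic : ∀ p q → norm (p , q) ∙ x ≡ zeroV → (p , q) ≡ 0₉
    anisotropic p q eq with norm (p , q) ≟₃ f0
    ... | yes n≡0 = norm-nonzero (p , q) n≡0
    ... | no n≢0 = contradiction eq (x-torsion _ n≢0)

  ℓ-sub : ∀ X Y → ℓ (X +₉ (-₉ Y)) ≡ ℓ X +ᵥ (f2 ∙ ℓ Y)
  ℓ-sub X Y = trans (ℓ-+ X (-₉ Y)) (cong (ℓ X +ᵥ_) (ℓ-neg Y))

  ℓ-injective : ∀ {X Y} → ℓ X ≡ ℓ Y → X ≡ Y
  ℓ-injective {X} {Y} eq = difference X Y (ℓ≡0⇒≡0 _ (begin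
    ℓ (X +₉ (-₉ Y))       ≡⟨ ℓ-sub X Y ⟩
    ℓ X +ᵥ (f2 ∙ ℓ Y)     ≡⟨ cong (_+ᵥ (f2 ∙ ℓ Y)) eq ⟩
    ℓ Y +ᵥ (f2 ∙ ℓ Y)     ≡⟨ identity (X₀ ⊕ f2 ⊙ X₀) 𝟘 (ℓ Y ∷ []) ⟩
    zeroV                 ∎))
    where
    opaque
      difference : ∀ X Y → X +₉ (-₉ Y) ≡ 0₉ → X ≡ Y
      difference = from-yes (all₉? λ X → all₉? λ Y → ((X +₉ (-₉ Y)) ≟₉ 0₉) →-dec (X ≟₉ Y))

  L : Point → V
  L (X , Y) = ℓ X +ᵥ b (ℓ Y)

  L-sub : ∀ p q → L (p -ₚ q) ≡ L p +ᵥ (f2 ∙ L q)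
  L-sub (X , Y) (X' , Y') = begin
    ℓ (X +₉ (-₉ X')) +ᵥ b (ℓ (Y +₉ (-₉ Y')))
      ≡⟨ cong₂ (λ u v → u +ᵥ b v) (ℓ-sub X X') (ℓ-sub Y Y') ⟩
    (ℓ X +ᵥ (f2 ∙ ℓ X')) +ᵥ b (ℓ Y +ᵥ (f2 ∙ ℓ Y'))
      ≡⟨ cong (_ +ᵥ_) (additive-sub (additive 1F) (ℓ Y) (ℓ Y')) ⟩
    (ℓ X +ᵥ (f2 ∙ ℓ X')) +ᵥ (b (ℓ Y) +ᵥ (f2 ∙ b (ℓ Y')))
      ≡⟨ identity ((X₀ ⊕ f2 ⊙ X₁) ⊕ (X₂ ⊕ f2 ⊙ X₃)) ((X₀ ⊕ X₂) ⊕ f2 ⊙ (X₁ ⊕ X₃))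
           (ℓ X ∷ ℓ X' ∷ b (ℓ Y) ∷ b (ℓ Y') ∷ []) ⟩
    L (X , Y) +ᵥ (f2 ∙ L (X' , Y')) ∎

  t₀-L : ∀ X Y → t 0F (L (X , Y)) ≡ ℓ X +ᵥ (f2 ∙ b (ℓ Y))
  t₀-L X Y = trans (additive 0F _ _) (cong₂ _+ᵥ_ (t₀-ℓ X) (t₀-bℓ Y))

  -- `t 0F` fixes ℓ X and negates b (ℓ Y), so its eigenprojections recover both components of L (X,
  -- Y); this makes L injective.
  L⁺ : ∀ p → ℓ (proj₁ p) ≡ f2 ∙ (L p +ᵥ t 0F (L p))
  L⁺ (X , Y) = trans (identity X₀ (f2 ⊙ ((X₀ ⊕ X₁) ⊕ (X₀ ⊕ f2 ⊙ X₁))) (ℓ X ∷ b (ℓ Y) ∷ []))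
    (cong (λ w → f2 ∙ (L (X , Y) +ᵥ w)) (sym (t₀-L X Y)))

  L⁻ : ∀ p → b (ℓ (proj₂ p)) ≡ f2 ∙ (L p +ᵥ (f2 ∙ t 0F (L p)))
  L⁻ (X , Y) = trans (identity X₁ (f2 ⊙ ((X₀ ⊕ X₁) ⊕ f2 ⊙ (X₀ ⊕ f2 ⊙ X₁))) (ℓ X ∷ b (ℓ Y) ∷ []))
    (cong (λ w → f2 ∙ (L (X , Y) +ᵥ (f2 ∙ w))) (sym (t₀-L X Y)))

  L-injective : ∀ {p q} → L p ≡ L q → p ≡ q
  L-injective {p} {q} eq = cong₂ _,_
    (ℓ-injective (trans (L⁺ p) (trans (cong (λ w → f2 ∙ (w +ᵥ t 0F w)) eq) (sym (L⁺ q)))))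
    (ℓ-injective (t-injective 1F (trans (L⁻ p)
      (trans (cong (λ w → f2 ∙ (w +ᵥ (f2 ∙ t 0F w))) eq) (sym (L⁻ q))))))

  L-0 : L 0ₚ ≡ zeroV
  L-0 = begin
    ℓ 0₉ +ᵥ b (ℓ 0₉)    ≡⟨ cong (λ w → w +ᵥ b w) ℓ-0 ⟩
    zeroV +ᵥ b zeroV    ≡⟨ +ᵥ-identityˡ _ ⟩
    b zeroV             ≡⟨ additive-0 (additive 1F) ⟩
    zeroV               ∎

  L≢0 : ∀ {p} → p ≢ 0ₚ → L p ≢ zeroV
  L≢0 p≢0 Lp≡0 = p≢0 (L-injective (trans Lp≡0 (sym L-0)))

  -- A mere regrouping of coordinates without geometric meaning: it turns L into a self-map of the
  -- finite set V.
  fromV : V → Point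
  fromV (p ∷ q ∷ r ∷ s ∷ []) = (p , q) , (r , s)

  fromV-injective : ∀ {u v} → fromV u ≡ fromV v → u ≡ v
  fromV-injective {_ ∷ _ ∷ _ ∷ _ ∷ []} {_ ∷ _ ∷ _ ∷ _ ∷ []} refl = refl

  opaque
    L-surjective : ∀ w → ∃ λ p → L p ≡ w
    L-surjective w = Product.map fromV id (injective⇒surjective enumeration (L ∘ fromV) (fromV-injective ∘ L-injective) w)

  ψ : Bij V Point
  ψ = record
    { to = λ w → proj₁ (L-surjective w)
    ; from = L
    ; to-from = λ p → L-injective (proj₂ (L-surjective (L p)))
    ; from-to = λ w → proj₂ (L-surjective w)
    }

  -- The colours of the ten slopes

  SlopeColour : Fin 5 → Slope → Set
  SlopeColour j n = ∀ p → p ≢ 0ₚ → On n p → colour (L p) ≡ j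

  PairColour : Fin 5 → Slope → Set
  PairColour j n = SlopeColour j n × SlopeColour j (mate n)

  bℓ-neg : ∀ Y → b (ℓ (-₉ Y)) ≡ f2 ∙ b (ℓ Y)
  bℓ-neg Y = trans (cong b (ℓ-neg Y)) (neg 1F (ℓ Y))

  -- An involution t fixes u + t u and negates u - t u; for u = ℓ X these are the points of slopes m
  -- and -m.
  mapped⇒slopeColour : ∀ j m → (∀ X → t j (ℓ X) ≡ b (ℓ (X ∘ₙ m))) →
    SlopeColour j (just m) × SlopeColour j (just (-₉ m))
  mapped⇒slopeColour j m tℓ≡bℓ = plus , minus
    where
    plus : SlopeColour j (just m)
    plus (X , _) p≢0 refl = eigen⇒colour j (L≢0 p≢0) (inj₁ (begin
      t j (ℓ X +ᵥ b (ℓ (X ∘ₙ m)))           ≡⟨ cong (λ w → t j (ℓ X +ᵥ w)) (sym (tℓ≡bℓ X)) ⟩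
      t j (ℓ X +ᵥ t j (ℓ X))                ≡⟨ additive j _ _ ⟩
      t j (ℓ X) +ᵥ t j (t j (ℓ X))          ≡⟨ cong₂ _+ᵥ_ (tℓ≡bℓ X) (involutive j (ℓ X)) ⟩
      b (ℓ (X ∘ₙ m)) +ᵥ ℓ X                 ≡⟨ +ᵥ-comm _ _ ⟩
      ℓ X +ᵥ b (ℓ (X ∘ₙ m))                 ∎))
    minus : SlopeColour j (just (-₉ m))
    minus (X , _) p≢0 refl = eigen⇒colour j (L≢0 p≢0) (inj₂ (begin
      t j (ℓ X +ᵥ b (ℓ (X ∘ₙ (-₉ m))))      ≡⟨ cong (λ w → t j (ℓ X +ᵥ w)) image ⟩
      t j (ℓ X +ᵥ (f2 ∙ t j (ℓ X)))         ≡⟨ additive-sub (additive j) _ _ ⟩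
      t j (ℓ X) +ᵥ (f2 ∙ t j (t j (ℓ X)))   ≡⟨ cong (λ w → t j (ℓ X) +ᵥ (f2 ∙ w)) (involutive j (ℓ X)) ⟩
      t j (ℓ X) +ᵥ (f2 ∙ ℓ X)               ≡⟨ identity (X₁ ⊕ f2 ⊙ X₀) (f2 ⊙ (X₀ ⊕ f2 ⊙ X₁)) (ℓ X ∷ t j (ℓ X) ∷ []) ⟩
      f2 ∙ (ℓ X +ᵥ (f2 ∙ t j (ℓ X)))        ≡⟨ cong (λ w → f2 ∙ (ℓ X +ᵥ w)) (sym image) ⟩
      f2 ∙ (ℓ X +ᵥ b (ℓ (X ∘ₙ (-₉ m))))     ∎))
      where
      image : b (ℓ (X ∘ₙ (-₉ m))) ≡ f2 ∙ t j (ℓ X)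
      image = trans (cong (b ∘ ℓ) (∘ₙ-‿- X m)) (trans (bℓ-neg (X ∘ₙ m)) (cong (f2 ∙_) (sym (tℓ≡bℓ X))))

  -- The two axes are the eigenspaces of `t 0F`: ℓ X is fixed and b (ℓ Y) is negated.
  pairColour₀ : PairColour 0F (just 0₉)
  pairColour₀ = horizontal , vertical
    where
    opaque
      ∘ₙ0 : ∀ X → X ∘ₙ 0₉ ≡ 0₉
      ∘ₙ0 = from-yes (all₉? λ X → (X ∘ₙ 0₉) ≟₉ 0₉)
    horizontal : SlopeColour 0F (just 0₉)
    horizontal (X , _) p≢0 refl = eigen⇒colour 0F (L≢0 p≢0) (inj₁ (begin
      t 0F (L (X , X ∘ₙ 0₉))                ≡⟨ t₀-L X (X ∘ₙ 0₉) ⟩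
      ℓ X +ᵥ (f2 ∙ b (ℓ (X ∘ₙ 0₉)))         ≡⟨ cong (ℓ X +ᵥ_) (sym (bℓ-neg (X ∘ₙ 0₉))) ⟩
      ℓ X +ᵥ b (ℓ (-₉ (X ∘ₙ 0₉)))           ≡⟨ cong (λ Y → ℓ X +ᵥ b (ℓ Y)) (trans (cong -₉_ (∘ₙ0 X)) (sym (∘ₙ0 X))) ⟩
      L (X , X ∘ₙ 0₉)                       ∎))
    vertical : SlopeColour 0F nothing
    vertical (_ , Y) p≢0 refl = eigen⇒colour 0F (L≢0 p≢0) (inj₂ (begin
      t 0F (L (0₉ , Y))                     ≡⟨ t₀-L 0₉ Y ⟩
      ℓ 0₉ +ᵥ (f2 ∙ b (ℓ Y))                ≡⟨ cong (_+ᵥ (f2 ∙ b (ℓ Y))) (trans ℓ-0 (identity 𝟘 (f2 ⊙ 𝟘) (x ∷ []))) ⟩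
      (f2 ∙ zeroV) +ᵥ (f2 ∙ b (ℓ Y))        ≡⟨ identity (f2 ⊙ 𝟘 ⊕ f2 ⊙ X₀) (f2 ⊙ (𝟘 ⊕ X₀)) (b (ℓ Y) ∷ []) ⟩
      f2 ∙ (zeroV +ᵥ b (ℓ Y))               ≡⟨ cong (λ w → f2 ∙ (w +ᵥ b (ℓ Y))) (sym ℓ-0) ⟩
      f2 ∙ L (0₉ , Y)                       ∎))

  pairColour₁ : PairColour 1F (just 1₉)
  pairColour₁ = mapped⇒slopeColour 1F 1₉ λ X → cong (b ∘ ℓ) (∘ₙ1 X)
    where
    opaque
      ∘ₙ1 : ∀ X → X ≡ X ∘ₙ 1₉
      ∘ₙ1 = from-yes (all₉? λ X → X ≟₉ (X ∘ₙ 1₉))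

  -- As b is an involution, `t 2F` is b J, and J multiplies by i, a square, so field and nearfield
  -- products agree.
  pairColour₂ : PairColour 2F (just i₉)
  pairColour₂ = mapped⇒slopeColour 2F i₉ λ X → begin
    t 2F (ℓ X)               ≡⟨ sym (involutive 1F _) ⟩
    b (J (ℓ X))              ≡⟨ cong b (J-ℓ X) ⟩
    b (ℓ (rot X))            ≡⟨ cong (b ∘ ℓ) (∘ₙi X) ⟩
    b (ℓ (X ∘ₙ i₉))          ∎
    where
    opaque
      ∘ₙi : ∀ X → rot X ≡ X ∘ₙ i₉
      ∘ₙi = from-yes (all₉? λ X → rot X ≟₉ (X ∘ₙ i₉))

  module Skew (j : Fin 5) (j≢0 : j ≢ 0F) (j≢1 : j ≢ 1F) (j≢2 : j ≢ 2F) where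

    preimage : Point
    preimage = proj₁ (L-surjective (t j x))

    m : F9
    m = proj₂ preimage

    -- t j x is negated by t 0, so its ℓ-component vanishes.
    tx≡bℓm : t j x ≡ b (ℓ m)
    tx≡bℓm = begin
      t j x                                ≡⟨ identity X₀ (f2 ⊙ (X₀ ⊕ f2 ⊙ f2 ⊙ X₀)) (t j x ∷ []) ⟩
      f2 ∙ (t j x +ᵥ (f2 ∙ (f2 ∙ t j x)))  ≡⟨ cong (λ w → f2 ∙ (t j x +ᵥ (f2 ∙ w))) (sym t₀tx) ⟩
      f2 ∙ (t j x +ᵥ (f2 ∙ t 0F (t j x)))  ≡⟨ cong (λ w → f2 ∙ (w +ᵥ (f2 ∙ t 0F w))) (sym (proj₂ (L-surjective (t j x)))) ⟩
      f2 ∙ (L preimage +ᵥ (f2 ∙ t 0F (L preimage))) ≡⟨ sym (L⁻ preimage) ⟩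
      b (ℓ m)                              ∎
      where
      t₀tx : t 0F (t j x) ≡ f2 ∙ t j x
      t₀tx = trans (anticommute 0F j (j≢0 ∘ sym) x) (cong (λ w → f2 ∙ t j w) t₀x≡x)

    tJx : t j (J x) ≡ b (ℓ (-₉ rot m))
    tJx = begin
      t j (J x)            ≡⟨ anticommute-J j j≢1 j≢2 x ⟩
      J (t j x)            ≡⟨ cong J tx≡bℓm ⟩
      J (b (ℓ m))          ≡⟨ J∘b (ℓ m) ⟩
      f2 ∙ b (J (ℓ m))     ≡⟨ cong (λ w → f2 ∙ b w) (J-ℓ m) ⟩
      f2 ∙ b (ℓ (rot m))   ≡⟨ sym (bℓ-neg (rot m)) ⟩
      b (ℓ (-₉ rot m))     ∎

    -- `t j` commutes with J while b anticommutes with it, so relative to b the map `t j` is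
    -- conjugate-linear and determined by the image of x.
    tℓ : ∀ X → t j (ℓ X) ≡ b (ℓ (frob X *₉ m))
    tℓ X@(p , q) = begin
      t j (ℓ X)                                       ≡⟨ additive-combination (additive j) p q x (J x) ⟩
      (p ∙ t j x) +ᵥ (q ∙ t j (J x))                  ≡⟨ cong₂ (λ u v → (p ∙ u) +ᵥ (q ∙ v)) tx≡bℓm tJx ⟩
      (p ∙ b (ℓ m)) +ᵥ (q ∙ b (ℓ (-₉ rot m)))         ≡⟨ sym (additive-combination (additive 1F) p q _ _) ⟩
      b ((p ∙ ℓ m) +ᵥ (q ∙ ℓ (-₉ rot m)))
        ≡⟨ cong b (sym (trans (ℓ-+ (p *ₛ m) (q *ₛ (-₉ rot m))) (cong₂ _+ᵥ_ (ℓ-*ₛ p m) (ℓ-*ₛ q (-₉ rot m))))) ⟩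
      b (ℓ ((p *ₛ m) +₉ (q *ₛ (-₉ rot m))))           ≡⟨ cong (b ∘ ℓ) (table p q m) ⟩
      b (ℓ (frob X *₉ m))                             ∎
      where
      opaque
        table : ∀ p q m → (p *ₛ m) +₉ (q *ₛ (-₉ rot m)) ≡ frob (p , q) *₉ m
        table = from-yes (all₃? λ p → all₃? λ q → all₉? λ m →
          ((p *ₛ m) +₉ (q *ₛ (-₉ rot m))) ≟₉ (frob (p , q) *₉ m))

    colour-1m : colour (L (1₉ , m)) ≡ j
    colour-1m = eigen⇒colour j (L≢0 {1₉ , m} λ ()) (inj₁ (begin
      t j (ℓ 1₉ +ᵥ b (ℓ m))      ≡⟨ cong₂ (λ u v → t j (u +ᵥ v)) ℓ-1 (sym tx≡bℓm) ⟩
      t j (x +ᵥ t j x)           ≡⟨ additive j _ _ ⟩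
      t j x +ᵥ t j (t j x)       ≡⟨ cong₂ _+ᵥ_ tx≡bℓm (involutive j x) ⟩
      b (ℓ m) +ᵥ x               ≡⟨ +ᵥ-comm _ _ ⟩
      x +ᵥ b (ℓ m)               ≡⟨ cong (_+ᵥ b (ℓ m)) (sym ℓ-1) ⟩
      ℓ 1₉ +ᵥ b (ℓ m)            ∎))

    -- The point (1, m) has colour j, so its slope cannot share the class of a slope already known
    -- to have another colour.
    not-class : ∀ {k n} → PairColour k n → j ≢ k → mateClass n ≢ mateClass (just m)
    not-class {k} {n} (plus , minus) j≢k eq with mateClass-injective n (just m) eq
    ... | inj₁ m≡n = j≢k (trans (sym colour-1m) (plus (1₉ , m) (λ ()) (subst (λ n → On n (1₉ , m)) m≡n (1∘ₙ m))))
    ... | inj₂ m≡n = j≢k (trans (sym colour-1m) (minus (1₉ , m) (λ ()) (subst (λ n → On n (1₉ , m)) m≡n (1∘ₙ m))))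

    -- The slopes 0, ∞, ±1 and ±i are taken by the first three colours, which leaves the nonsquares.
    nonsquare : norm m ≡ f2
    nonsquare = table m (not-class {n = just 0₉} pairColour₀ j≢0)
      (not-class {n = just 1₉} pairColour₁ j≢1) (not-class {n = just i₉} pairColour₂ j≢2)
      where
      opaque
        table : ∀ m → 0F ≢ mateClass (just m) → 1F ≢ mateClass (just m) → 2F ≢ mateClass (just m) → norm m ≡ f2
        table = from-yes (all₉? λ m →
          ¬? (0F Fin.≟ mateClass (just m)) →-dec (¬? (1F Fin.≟ mateClass (just m)) →-dec
          (¬? (2F Fin.≟ mateClass (just m)) →-dec (norm m ≟₃ f2))))

    pairColour : PairColour j (just m)
    -- For a nonsquare m the nearfield product is the conjugate-linear one, and m ≠ 0, so the mate
    -- of m is -m.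
    pairColour = proj₁ both , subst (SlopeColour j) (table m nonsquare) (proj₂ both)
      where
      opaque
        frob*≡∘ₙ : ∀ m X → norm m ≡ f2 → frob X *₉ m ≡ X ∘ₙ m
        frob*≡∘ₙ = from-yes (all₉? λ m → all₉? λ X → (norm m ≟₃ f2) →-dec ((frob X *₉ m) ≟₉ (X ∘ₙ m)))
      both : SlopeColour j (just m) × SlopeColour j (just (-₉ m))
      both = mapped⇒slopeColour j m λ X → trans (tℓ X) (cong (b ∘ ℓ) (frob*≡∘ₙ m X nonsquare))
      opaque
        table : ∀ m → norm m ≡ f2 → just (-₉ m) ≡ mate (just m)
        table = from-yes (all₉? λ m → (norm m ≟₃ f2) →-dec (just (-₉ m) ≟ₛ mate (just m)))

  slopeOf : ∀ j → ∃ λ n → PairColour j n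
  slopeOf 0F = just 0₉ , pairColour₀
  slopeOf 1F = just 1₉ , pairColour₁
  slopeOf 2F = just i₉ , pairColour₂
  slopeOf 3F = just (Skew.m 3F (λ ()) (λ ()) (λ ())) , Skew.pairColour 3F (λ ()) (λ ()) (λ ())
  slopeOf 4F = just (Skew.m 4F (λ ()) (λ ()) (λ ())) , Skew.pairColour 4F (λ ()) (λ ()) (λ ())

  pairColour-class : ∀ {j n n'} → PairColour j n → mateClass n ≡ mateClass n' → SlopeColour j n'
  pairColour-class {n = n} {n'} (plus , minus) eq with mateClass-injective n n' eq
  ... | inj₁ refl = plus
  ... | inj₂ refl = minus

  direction : ∀ n → ∃ λ p → p ≢ 0ₚ × On n p
  direction nothing = (0₉ , 1₉) , (λ ()) , refl
  direction (just m) = (1₉ , 1₉ ∘ₙ m) , (λ ()) , refl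

  classOf : Fin 5 → Fin 5
  classOf j = mateClass (proj₁ (slopeOf j))

  classOf-injective : ∀ {j k} → classOf j ≡ classOf k → j ≡ k
  classOf-injective {j} {k} eq with direction (proj₁ (slopeOf k))
  ... | p , p≢0 , on = trans (sym (pairColour-class (proj₂ (slopeOf j)) eq p p≢0 on))
    (proj₁ (proj₂ (slopeOf k)) p p≢0 on)

  -- An injection from five colours to five classes is onto. It is thus unnecessary to decide which
  -- nonsquare class belongs to `3F` and which to `4F`.
  colourOf-slope : ∀ n → ∃ λ j → classOf j ≡ mateClass n
  colourOf-slope n = injective⇒surjective idᵇ classOf classOf-injective (mateClass n)
    where
    idᵇ : Bij (Fin 5) (Fin 5)
    idᵇ = record { to = id ; from = id ; to-from = λ _ → refl ; from-to = λ _ → refl }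

  Γ : Slope → Fin 5
  Γ n = proj₁ (colourOf-slope n)

  Γ-colour : ∀ n → SlopeColour (Γ n) n
  Γ-colour n = pairColour-class (proj₂ (slopeOf (Γ n))) (proj₂ (colourOf-slope n))

  Γ-mate : ∀ n n' → Γ n ≡ Γ n' → (n' ≡ n) ⊎ (n' ≡ mate n)
  Γ-mate n n' eq = mateClass-injective n n'
    (trans (sym (proj₂ (colourOf-slope n))) (trans (cong classOf eq) (proj₂ (colourOf-slope n'))))

-- Sets of points

opaque
  ∈-allV : ∀ u → u ∈ allV
  ∈-allV = from-yes (allVec? λ u → u ∈? allV)
    where open DecMembership _≟ᵥ_ using (_∈?_)

  allV-unique : Unique allV
  allV-unique = from-yes (unique? allV)
    where open DecUnique _≟ᵥ_ using (unique?)

allF9 : List F9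
allF9 = cartesianProduct (f0 ∷ f1 ∷ f2 ∷ []) (f0 ∷ f1 ∷ f2 ∷ [])

opaque
  ∈-allF9 : ∀ u → u ∈ allF9
  ∈-allF9 = from-yes (all₉? λ u → u ∈? allF9)
    where open DecMembership _≟₉_ using (_∈?_)

  allF9-unique : Unique allF9
  allF9-unique = from-yes (unique? allF9)
    where open DecUnique _≟₉_ using (unique?)

opaque
  someV? : {P : V → Set} → (∀ u → Dec (P u)) → Dec (∃ P)
  someV? P? = map′ (λ p → proj₁ (find p) , proj₂ (proj₂ (find p))) (λ (u , p) → lose (∈-allV u) p) (any? P? allV)

iff⇒≡ : ∀ {a b} → ((a ≡ true) iff (b ≡ true)) → a ≡ b
iff⇒≡ {true} (f , _) = sym (f refl)
iff⇒≡ {false} {true} (_ , g) = g refl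
iff⇒≡ {false} {false} _ = refl

-- Two duplicate-free lists with the same members are permutations of each other, here the filtered
-- list of V and the image of GF(9).
sizeV-enumerated : ∀ S (f : F9 → V) → (∀ {X Y} → f X ≡ f Y → X ≡ Y) →
  (∀ X → S (f X) ≡ true) → (∀ u → S u ≡ true → ∃ λ X → f X ≡ u) → sizeV S ≡ 9
sizeV-enumerated S f f-injective f∈S S⊆f = trans
  (↭-length (∼bag⇒↭ (unique∧set⇒bag (Unique.filter⁺ S? allV-unique) (Unique.map⁺ f-injective allF9-unique)
    (mk⇔ forward backward))))
  (length-map f allF9)
  where
  S? : ∀ u → Dec (S u ≡ true)
  S? u = S u Bool.≟ true
  forward : ∀ {u} → u ∈ filter S? allV → u ∈ map f allF9
  forward {u} u∈ with S⊆f u (proj₂ (∈-filter⁻ S? {xs = allV} u∈))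
  ... | X , refl = ∈-map⁺ f (∈-allF9 X)
  backward : ∀ {u} → u ∈ map f allF9 → u ∈ filter S? allV
  backward u∈ with ∈-map⁻ f u∈
  ... | X , _ , refl = ∈-filter⁺ S? (∈-allV (f X)) (f∈S X)

-- The lines of the nearfield plane

Line : Set
Line = (F9 × F9) ⊎ F9

infix 4 _∈ℓ_

_∈ℓ_ : Point → Line → Set
p ∈ℓ inj₁ (m , b) = proj₂ p ≡ (proj₁ p ∘ₙ m) +₉ b
p ∈ℓ inj₂ a = proj₁ p ≡ a

_∈ℓ?_ : ∀ p l → Dec (p ∈ℓ l)
p ∈ℓ? inj₁ (m , b) = proj₂ p ≟₉ ((proj₁ p ∘ₙ m) +₉ b)
p ∈ℓ? inj₂ a = proj₁ p ≟₉ a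

slope : Line → Slope
slope (inj₁ (m , _)) = just m
slope (inj₂ _) = nothing

point : Line → F9 → Point
point (inj₁ (m , b)) x = x , ((x ∘ₙ m) +₉ b)
point (inj₂ a) y = a , y

point-injective : ∀ l {X Y} → point l X ≡ point l Y → X ≡ Y
point-injective (inj₁ _) = cong proj₁
point-injective (inj₂ _) = cong proj₂

point-∈ℓ : ∀ l X → point l X ∈ℓ l
point-∈ℓ (inj₁ _) X = refl
point-∈ℓ (inj₂ _) X = refl

∈ℓ⇒point : ∀ l p → p ∈ℓ l → ∃ λ X → point l X ≡ p
∈ℓ⇒point (inj₁ _) (x , _) refl = x , refl
∈ℓ⇒point (inj₂ _) (_ , y) refl = y , refl

opaque
  +₉-cancelˡ : ∀ s b b' → s +₉ b ≡ s +₉ b' → b ≡ b'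
  +₉-cancelˡ = from-yes (all₉? λ s → all₉? λ b → all₉? λ b' → ((s +₉ b) ≟₉ (s +₉ b')) →-dec (b ≟₉ b'))

  +₉-sub-+ : ∀ s b s' → (s +₉ b) +₉ (-₉ (s' +₉ b)) ≡ s +₉ (-₉ s')
  +₉-sub-+ = from-yes (all₉? λ s → all₉? λ b → all₉? λ s' →
    ((s +₉ b) +₉ (-₉ (s' +₉ b))) ≟₉ (s +₉ (-₉ s')))

  +₉-sub-cancel : ∀ p q r → (p +₉ (-₉ r)) +₉ (-₉ (q +₉ (-₉ r))) ≡ p +₉ (-₉ q)
  +₉-sub-cancel = from-yes (all₉? λ p → all₉? λ q → all₉? λ r →
    ((p +₉ (-₉ r)) +₉ (-₉ (q +₉ (-₉ r)))) ≟₉ (p +₉ (-₉ q)))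

  +₉-inverseʳ : ∀ p → p +₉ (-₉ p) ≡ 0₉
  +₉-inverseʳ = from-yes (all₉? λ p → (p +₉ (-₉ p)) ≟₉ 0₉)

  +₉-sub≡0 : ∀ p q → p +₉ (-₉ q) ≡ 0₉ → p ≡ q
  +₉-sub≡0 = from-yes (all₉? λ p → all₉? λ q → ((p +₉ (-₉ q)) ≟₉ 0₉) →-dec (p ≟₉ q))

  +₉-shift : ∀ s y s' → s +₉ (y +₉ (-₉ s')) ≡ y +₉ (s +₉ (-₉ s'))
  +₉-shift = from-yes (all₉? λ s → all₉? λ y → all₉? λ s' →
    (s +₉ (y +₉ (-₉ s'))) ≟₉ (y +₉ (s +₉ (-₉ s'))))

  +₉-sub-solve : ∀ y y' d → y' +₉ (-₉ y) ≡ d → y' ≡ y +₉ d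
  +₉-sub-solve = from-yes (all₉? λ y → all₉? λ y' → all₉? λ d →
    ((y' +₉ (-₉ y)) ≟₉ d) →-dec (y' ≟₉ (y +₉ d)))

-ₚ-cancel : ∀ p q r → (p -ₚ r) -ₚ (q -ₚ r) ≡ p -ₚ q
-ₚ-cancel (x , y) (x' , y') (x'' , y'') = cong₂ _,_ (+₉-sub-cancel x x' x'') (+₉-sub-cancel y y' y'')

-ₚ-self : ∀ p → p -ₚ p ≡ 0ₚ
-ₚ-self (x , y) = cong₂ _,_ (+₉-inverseʳ x) (+₉-inverseʳ y)

-ₚ≡0 : ∀ {p q} → p -ₚ q ≡ 0ₚ → p ≡ q
-ₚ≡0 eq = cong₂ _,_ (+₉-sub≡0 _ _ (cong proj₁ eq)) (+₉-sub≡0 _ _ (cong proj₂ eq))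

line : Slope → Point → Line
line (just m) (x , y) = inj₁ (m , (y +₉ (-₉ (x ∘ₙ m))))
line nothing (x , _) = inj₂ x

_∼[_]_ : Point → Slope → Point → Set
p ∼[ n ] q = On n (q -ₚ p)

∼-refl : ∀ n p → p ∼[ n ] p
∼-refl n p = subst (On n) (sym (-ₚ-self p)) (On-0 n)
  where
  On-0 : ∀ n → On n 0ₚ
  On-0 (just m) = sym (0∘ₙ m)
  On-0 nothing = refl

-- r - q = (r - p) - (q - p), and lines through the origin are closed under subtraction. With
-- reflexivity this gives an equivalence relation whose classes are the lines of slope n.
∼-euclidean : ∀ n {p q r} → p ∼[ n ] q → p ∼[ n ] r → q ∼[ n ] r
∼-euclidean n {p} {q} {r} p∼q p∼r = subst (On n) (-ₚ-cancel r q p) (On-sub n p∼r p∼q)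

∼-sym : ∀ n {p q} → p ∼[ n ] q → q ∼[ n ] p
∼-sym n {p} {q} p∼q = ∼-euclidean n {p} {q} {p} p∼q (∼-refl n p)

∼-unique : ∀ n n' {p q} → p ≢ q → p ∼[ n ] q → p ∼[ n' ] q → n ≡ n'
∼-unique n n' p≢q = On-unique n n' _ (p≢q ∘ sym ∘ -ₚ≡0)

slope-line : ∀ n p → slope (line n p) ≡ n
slope-line (just _) _ = refl
slope-line nothing _ = refl

∈ℓ⇒∼ : ∀ l {p q} → p ∈ℓ l → q ∈ℓ l → p ∼[ slope l ] q
∈ℓ⇒∼ (inj₁ (m , b)) {x , _} {x' , _} refl refl = trans (+₉-sub-+ (x' ∘ₙ m) b (x ∘ₙ m)) (sym (∘ₙ-sub m x' x))
∈ℓ⇒∼ (inj₂ a) refl refl = +₉-inverseʳ a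

∼⇒∈ℓ-line : ∀ n {p q} → p ∼[ n ] q → q ∈ℓ line n p
∼⇒∈ℓ-line (just m) {x , y} {x' , y'} eq = begin
  y'                                       ≡⟨ +₉-sub-solve y y' _ eq ⟩
  y +₉ ((x' +₉ (-₉ x)) ∘ₙ m)               ≡⟨ cong (y +₉_) (∘ₙ-sub m x' x) ⟩
  y +₉ ((x' ∘ₙ m) +₉ (-₉ (x ∘ₙ m)))        ≡⟨ sym (+₉-shift (x' ∘ₙ m) y (x ∘ₙ m)) ⟩
  (x' ∘ₙ m) +₉ (y +₉ (-₉ (x ∘ₙ m)))        ∎
  where open ≡-Reasoning
∼⇒∈ℓ-line nothing {x , _} {x' , _} eq = +₉-sub≡0 x' x eq

∈ℓ-line : ∀ n p → p ∈ℓ line n p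
∈ℓ-line n p = ∼⇒∈ℓ-line n (∼-refl n p)

parallel-unique : ∀ l l' {p} → slope l ≡ slope l' → p ∈ℓ l → p ∈ℓ l' → l ≡ l'
parallel-unique (inj₁ (m , b)) (inj₁ (_ , b')) {x , _} refl refl eq =
  cong (λ b → inj₁ (m , b)) (+₉-cancelˡ (x ∘ₙ m) b b' eq)
parallel-unique (inj₂ _) (inj₂ _) _ refl refl = refl

line-unique : ∀ l l' {p q} → p ≢ q → p ∈ℓ l → q ∈ℓ l → p ∈ℓ l' → q ∈ℓ l' → l ≡ l'
line-unique l l' p≢q p∈l q∈l p∈l' q∈l' = parallel-unique l l'
  (∼-unique (slope l) (slope l') p≢q (∈ℓ⇒∼ l p∈l q∈l) (∈ℓ⇒∼ l' p∈l' q∈l')) p∈l p∈l'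

∼⇒∈ℓ : ∀ l {p q} → p ∈ℓ l → p ∼[ slope l ] q → q ∈ℓ l
∼⇒∈ℓ l {p} {q} p∈l p∼q = subst (q ∈ℓ_)
  (parallel-unique (line (slope l) p) l {p} (slope-line (slope l) p) (∈ℓ-line (slope l) p) p∈l)
  (∼⇒∈ℓ-line (slope l) p∼q)

-- 90 = 9 · 9 + 9: slope and intercept of a sloped line, or the abscissa of a vertical one.
lines↔ : Fin 90 ↔ Line
lines↔ = ↔-trans (Fin.+↔⊎ {81} {9}) (↔-trans (Fin.*↔× {9} {9}) (F9↔ ×-↔ F9↔) ⊎-↔ F9↔)
  where
  F3↔ : Fin 3 ↔ F3
  F3↔ = mk↔ₛ′ (λ { 0F → f0 ; 1F → f1 ; 2F → f2 }) (λ { f0 → 0F ; f1 → 1F ; f2 → 2F })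
    (λ { f0 → refl ; f1 → refl ; f2 → refl }) (λ { 0F → refl ; 1F → refl ; 2F → refl })
  F9↔ : Fin 9 ↔ F9
  F9↔ = ↔-trans (Fin.*↔× {3} {3}) (F3↔ ×-↔ F3↔)

-- The blocks are the lines of the nearfield plane

record SpreadColouring (c : V → V → Fin 5) : Set where
  field
    ψ       : Bij V Point
    Γ       : Slope → Fin 5
    Γ-mate  : ∀ n n' → Γ n ≡ Γ n' → (n' ≡ n) ⊎ (n' ≡ mate n)
    Γ-onto  : ∀ i → ∃ λ n → Γ n ≡ i
    c-slope : ∀ n x y → x ≢ y → to ψ x ∼[ n ] to ψ y → c x y ≡ Γ n

module Plane (c : V → V → Fin 5) (C : SpreadColouring c) where
  open SpreadColouring C

  ψ≢ : ∀ {x y} → x ≢ y → to ψ x ≢ to ψ y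
  ψ≢ x≢y eq = x≢y (to-injective ψ eq)

  slopeBetween : ∀ x y → ∃ λ n → to ψ x ∼[ n ] to ψ y
  slopeBetween x y = On-exists (to ψ y -ₚ to ψ x)

  Represents : Line → (V → Bool) → Set
  Represents l S = ∀ x → (S x ≡ true) iff (to ψ x ∈ℓ l)

  lineSet : Line → V → Bool
  lineSet l x = does (to ψ x ∈ℓ? l)

  represents-lineSet : ∀ l → Represents l (lineSet l)
  represents-lineSet l x with to ψ x ∈ℓ? l
  ... | yes x∈l = (λ _ → x∈l) , λ _ → refl
  ... | no x∉l = (λ ()) , λ x∈l → contradiction x∈l x∉l

  represents-≐ : ∀ {l S S'} → Represents l S → Represents l S' → S ≐ S'
  represents-≐ r r' x = iff⇒≡ (proj₂ (r' x) ∘ proj₁ (r x) , proj₂ (r x) ∘ proj₁ (r' x))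

  represents⇒clique : ∀ l {S} → Represents l S → IsClique c (Γ (slope l)) S
  represents⇒clique l r x y x∈S y∈S x≢y = c-slope (slope l) x y x≢y (∈ℓ⇒∼ l (proj₁ (r x) x∈S) (proj₁ (r y) y∈S))

  -- A vertex z off the line would see two of its points in the mate direction.
  represents⇒block : ∀ l {S} → Represents l S → Block c S
  represents⇒block l {S} r = Γ (slope l) , represents⇒clique l r , maximal
    where
    maximal : ∀ z → S z ≡ false → (∀ x → x ∈ₛ S → c x z ≡ Γ (slope l)) → ⊥
    maximal z z∉S adjacent = slopes≢ (∼-unique (mate (slope l)) (slope l)
      (λ eq → 0₉≢1₉ (point-injective l eq))
      (∼-euclidean (mate (slope l)) {to ψ z} (via 0₉) (via 1₉)) (∈ℓ⇒∼ l (point-∈ℓ l 0₉) (point-∈ℓ l 1₉)))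
      where
      z∉l : ¬ (to ψ z ∈ℓ l)
      z∉l z∈l = contradiction (trans (sym z∉S) (proj₂ (r z) z∈l)) λ ()
      at : F9 → V
      at X = from ψ (point l X)
      ψ-at : ∀ X → to ψ (at X) ≡ point l X
      ψ-at X = to-from ψ (point l X)
      at∈l : ∀ X → to ψ (at X) ∈ℓ l
      at∈l X = subst (_∈ℓ l) (sym (ψ-at X)) (point-∈ℓ l X)
      at≢z : ∀ X → at X ≢ z
      at≢z X refl = z∉l (at∈l X)
      mated : ∀ X → to ψ (at X) ∼[ mate (slope l) ] to ψ z
      mated X with slopeBetween (at X) z
      ... | n , on with Γ-mate (slope l) n
        (trans (sym (adjacent (at X) (proj₂ (r (at X)) (at∈l X)))) (c-slope n (at X) z (at≢z X) on))
      ... | inj₁ refl = contradiction (∼⇒∈ℓ l (at∈l X) on) z∉l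
      ... | inj₂ refl = on
      via : ∀ X → to ψ z ∼[ mate (slope l) ] point l X
      via X = subst (to ψ z ∼[ mate (slope l) ]_) (ψ-at X) (∼-sym (mate (slope l)) {to ψ (at X)} (mated X))
      -- If both slopes agreed, the mate direction would already put z on l; no inspection of the
      -- slopes is needed.
      slopes≢ : mate (slope l) ≢ slope l
      slopes≢ eq = z∉l (∼⇒∈ℓ l (point-∈ℓ l 0₉)
        (subst (point l 0₉ ∼[_] to ψ z) eq (∼-sym (mate (slope l)) {to ψ z} (via 0₉))))

  -- Of three slopes in {n, mate n} around a triangle two agree, hence all do.
  triangle : ∀ {S i} → IsClique c i S → ∀ {x y z n} → x ∈ₛ S → y ∈ₛ S → z ∈ₛ S → x ≢ y → x ≢ z → y ≢ z →
    to ψ x ∼[ n ] to ψ y → to ψ x ∼[ n ] to ψ z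
  triangle clique {x} {y} {z} {n} x∈S y∈S z∈S x≢y x≢z y≢z xy
    with slopeBetween x z | slopeBetween y z
  ... | n₁ , xz | n₂ , yz with mated n₁ x z x≢z xz (clique x z x∈S z∈S x≢z) | mated n₂ y z y≢z yz (clique y z y∈S z∈S y≢z)
    where
    mated : ∀ n' u w → u ≢ w → to ψ u ∼[ n' ] to ψ w → c u w ≡ _ → (n' ≡ n) ⊎ (n' ≡ mate n)
    mated n' u w u≢w uw eq = Γ-mate n n' (trans (sym (c-slope n x y x≢y xy))
      (trans (clique x y x∈S y∈S x≢y) (trans (sym eq) (c-slope n' u w u≢w uw))))
  ... | inj₁ refl | _ = xz
  ... | inj₂ refl | inj₁ refl = ∼-euclidean n {to ψ y} (∼-sym n {to ψ x} xy) yz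
  ... | inj₂ refl | inj₂ refl = subst (to ψ x ∼[_] to ψ z)
    (∼-unique (mate n) n (ψ≢ x≢y)
      (∼-euclidean (mate n) {to ψ z} (∼-sym (mate n) {to ψ x} xz) (∼-sym (mate n) {to ψ y} yz)) xy) xz

  -- A clique lies on a line through any of its points, in the direction of a second one; since that
  -- line is itself a clique of the same colour, maximality makes S all of it.
  block⇒represents : ∀ S → Block c S → ∃ λ l → Represents l S
  block⇒represents S (i , clique , maximal) = line n x₀ , represents
    where
    x∈ : ∃ λ x → x ∈ₛ S
    x∈ with someV? (λ x → S x Bool.≟ true)
    ... | yes p = p
    -- The empty set is not maximal: every vertex is vacuously adjacent to all of it.
    ... | no empty = ⊥-elim (maximal zeroV (¬-not λ p → empty (zeroV , p)) λ x x∈S → contradiction (x , x∈S) empty)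
    x : V
    x = proj₁ x∈
    x₀ : Point
    x₀ = to ψ x
    direction-of-S : ∃ λ n → Γ n ≡ i × (∀ s → s ∈ₛ S → x₀ ∼[ n ] to ψ s)
    direction-of-S with someV? (λ y → ¬? (x ≟ᵥ y) ×-dec (S y Bool.≟ true))
    -- One point gives no direction, but any slope of colour i serves.
    ... | no single = proj₁ (Γ-onto i) , proj₂ (Γ-onto i) , λ s s∈S → case-s s s∈S
      where
      case-s : ∀ s → s ∈ₛ S → x₀ ∼[ proj₁ (Γ-onto i) ] to ψ s
      case-s s s∈S with x ≟ᵥ s
      ... | yes eq = subst (λ u → x₀ ∼[ proj₁ (Γ-onto i) ] to ψ u) eq (∼-refl (proj₁ (Γ-onto i)) x₀)
      ... | no x≢s = contradiction (s , x≢s , s∈S) single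
    ... | yes (y , x≢y , y∈S) = m , trans (sym (c-slope m x y x≢y xy)) (clique x y (proj₂ x∈) y∈S x≢y) , all
      where
      m : Slope
      m = proj₁ (slopeBetween x y)
      xy : x₀ ∼[ m ] to ψ y
      xy = proj₂ (slopeBetween x y)
      all : ∀ s → s ∈ₛ S → x₀ ∼[ m ] to ψ s
      all s s∈S with x ≟ᵥ s | y ≟ᵥ s
      ... | yes eq | _ = subst (λ u → x₀ ∼[ m ] to ψ u) eq (∼-refl m x₀)
      ... | no _ | yes eq = subst (λ u → x₀ ∼[ m ] to ψ u) eq xy
      ... | no x≢s | no y≢s = triangle clique {n = m} (proj₂ x∈) y∈S s∈S x≢y x≢s y≢s xy
    n : Slope
    n = proj₁ direction-of-S
    Γn≡i : Γ n ≡ i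
    Γn≡i = proj₁ (proj₂ direction-of-S)
    S⊆l : ∀ s → s ∈ₛ S → x₀ ∼[ n ] to ψ s
    S⊆l = proj₂ (proj₂ direction-of-S)
    represents : Represents (line n x₀) S
    -- Conversely, a point of the line outside S would be adjacent to all of S, against maximality.
    represents z = (λ z∈S → ∼⇒∈ℓ-line n (S⊆l z z∈S)) , λ z∈l → decidable-stable (S z Bool.≟ true) λ z∉S →
      maximal z (¬-not z∉S) λ s s∈S → trans
        (c-slope n s z (λ { refl → z∉S s∈S })
          (∼-euclidean n {x₀} (S⊆l s s∈S)
            (subst (x₀ ∼[_] to ψ z) (slope-line n x₀) (∈ℓ⇒∼ (line n x₀) (∈ℓ-line n x₀) z∈l))))
        Γn≡i

  block-size : ∀ S → Block c S → sizeV S ≡ 9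
  block-size S S-block with block⇒represents S S-block
  ... | l , r = sizeV-enumerated S (from ψ ∘ point l) (point-injective l ∘ from-injective ψ)
    (λ X → proj₂ (r _) (subst (_∈ℓ l) (sym (to-from ψ (point l X))) (point-∈ℓ l X)))
    λ u u∈S → enumerate u (∈ℓ⇒point l (to ψ u) (proj₁ (r u) u∈S))
    where
    enumerate : ∀ u → (∃ λ X → point l X ≡ to ψ u) → ∃ λ X → from ψ (point l X) ≡ u
    enumerate u (X , eq) = X , trans (cong (from ψ) eq) (from-to ψ u)

  -- The points of l with parameters 0 and 1 are distinct and lie on l' as well.
  represents-injective : ∀ {l l' S S'} → Represents l S → Represents l' S' → S ≐ S' → l ≡ l'
  represents-injective {l} {l'} r r' S≐S' = line-unique l l' (λ eq → 0₉≢1₉ (point-injective l eq))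
    (point-∈ℓ l 0₉) (point-∈ℓ l 1₉) (transfer 0₉) (transfer 1₉)
    where
    transfer : ∀ X → point l X ∈ℓ l'
    transfer X = subst (_∈ℓ l') ψu (proj₁ (r' u)
      (trans (sym (S≐S' u)) (proj₂ (r u) (subst (_∈ℓ l) (sym ψu) (point-∈ℓ l X)))))
      where
      u : V
      u = from ψ (point l X)
      ψu : to ψ u ≡ point l X
      ψu = to-from ψ (point l X)

  ninety-blocks : Σ (Vec (V → Bool) 90) λ bs →
      (∀ k → Block c (lookup bs k))
    × (∀ S → Block c S → ∃ λ k → S ≐ lookup bs k)
    × (∀ j k → lookup bs j ≐ lookup bs k → j ≡ k)
  ninety-blocks = bs
    , (λ k → represents⇒block (lineAt k) (represents-bs k))
    , (λ S S-block → index S (block⇒represents S S-block))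
    , λ j k eq → Injection.injective (↔⇒↣ lines↔) (represents-injective (represents-bs j) (represents-bs k) eq)
    where
    lineAt : Fin 90 → Line
    lineAt = Inverse.to lines↔
    bs : Vec (V → Bool) 90
    bs = tabulate (lineSet ∘ lineAt)
    represents-bs : ∀ k → Represents (lineAt k) (lookup bs k)
    represents-bs k = subst (Represents (lineAt k)) (sym (lookup∘tabulate (lineSet ∘ lineAt) k))
      (represents-lineSet (lineAt k))
    index : ∀ S → (∃ λ l → Represents l S) → ∃ λ k → S ≐ lookup bs k
    index S (l , r) = k
      , represents-≐ (subst (λ l → Represents l S) (sym (Inverse.strictlyInverseˡ lines↔ l)) r) (represents-bs k)
      where
      k : Fin 90
      k = Inverse.from lines↔ l

  block-through : ∀ x y → ∃ λ S → Block c S × x ∈ₛ S × y ∈ₛ S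
  block-through x y = lineSet l , represents⇒block l (represents-lineSet l)
    , proj₂ (represents-lineSet l x) (∈ℓ-line (proj₁ n∼) (to ψ x))
    , proj₂ (represents-lineSet l y) (∼⇒∈ℓ-line (proj₁ n∼) (proj₂ n∼))
    where
    n∼ : ∃ λ n → to ψ x ∼[ n ] to ψ y
    n∼ = slopeBetween x y
    l : Line
    l = line (proj₁ n∼) (to ψ x)

  block-unique : ∀ x y S S' → x ≢ y → Block c S → Block c S' →
    x ∈ₛ S → y ∈ₛ S → x ∈ₛ S' → y ∈ₛ S' → S ≐ S'
  block-unique x y S S' x≢y S-block S'-block x∈S y∈S x∈S' y∈S'
    with block⇒represents S S-block | block⇒represents S' S'-block
  ... | l , r | l' , r' with line-unique l l' (ψ≢ x≢y)
    (proj₁ (r x) x∈S) (proj₁ (r y) y∈S) (proj₁ (r' x) x∈S') (proj₁ (r' y) y∈S')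
  ... | refl = represents-≐ r r'

  nearfield-lines : ∀ S → Block c S iff NearfieldLine (λ p → S (from ψ p))
  nearfield-lines S = (λ S-block → forward (block⇒represents S S-block)) , backward
    where
    transfer : ∀ l → Represents l S → ∀ p → (S (from ψ p) ≡ true) iff (p ∈ℓ l)
    transfer l r p = subst (λ q → (S (from ψ p) ≡ true) iff (q ∈ℓ l)) (to-from ψ p) (r (from ψ p))
    transfer⁻¹ : ∀ l → (∀ p → (S (from ψ p) ≡ true) iff (p ∈ℓ l)) → Represents l S
    transfer⁻¹ l r x = subst (λ u → (S u ≡ true) iff (to ψ x ∈ℓ l)) (from-to ψ x) (r (to ψ x))
    forward : (∃ λ l → Represents l S) → NearfieldLine (λ p → S (from ψ p))
    forward (l@(inj₁ (m , b)) , r) = inj₁ (m , b , transfer l r)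
    forward (l@(inj₂ a) , r) = inj₂ (a , transfer l r)
    backward : NearfieldLine (λ p → S (from ψ p)) → Block c S
    backward (inj₁ (m , b , r)) = represents⇒block (inj₁ (m , b)) (transfer⁻¹ (inj₁ (m , b)) r)
    backward (inj₂ (a , r)) = represents⇒block (inj₂ a) (transfer⁻¹ (inj₂ a) r)

-- The action of G on the blocks

automorphism : ∀ {M G c} → HomFact M G c → ∀ g S → G g → Block c S → Block c (λ x → S (from g x))
automorphism {c = c} H g S g∈G (i , clique , maximal) = σ i , image-clique , image-maximal
  where
  open HomFact H
  open ≡-Reasoning
  σ σ⁻¹ : Fin 5 → Fin 5
  σ = proj₁ (G-invariant g g∈G)
  σ⁻¹ = proj₁ (G-invariant (g ⁻¹ₚ) (IsSubgroup.⁻¹∈ G-subgroup g∈G))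
  c-g : ∀ x y → x ≢ y → c (to g x) (to g y) ≡ σ (c x y)
  c-g = proj₂ (G-invariant g g∈G)
  c-g⁻¹ : ∀ x y → x ≢ y → c (from g x) (from g y) ≡ σ⁻¹ (c x y)
  c-g⁻¹ = proj₂ (G-invariant (g ⁻¹ₚ) (IsSubgroup.⁻¹∈ G-subgroup g∈G))
  σ⁻¹σ : ∀ x y → x ≢ y → σ⁻¹ (σ (c x y)) ≡ c x y
  σ⁻¹σ x y x≢y = begin
    σ⁻¹ (σ (c x y))                              ≡⟨ cong σ⁻¹ (sym (c-g x y x≢y)) ⟩
    σ⁻¹ (c (to g x) (to g y))                    ≡⟨ sym (c-g⁻¹ (to g x) (to g y) (x≢y ∘ to-injective g)) ⟩
    c (from g (to g x)) (from g (to g y))        ≡⟨ cong₂ c (from-to g x) (from-to g y) ⟩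
    c x y                                        ∎
  image-clique : IsClique c (σ i) (λ x → S (from g x))
  image-clique x y x∈ y∈ x≢y = begin
    c x y                                        ≡⟨ cong₂ c (sym (to-from g x)) (sym (to-from g y)) ⟩
    c (to g (from g x)) (to g (from g y))        ≡⟨ c-g _ _ x'≢y' ⟩
    σ (c (from g x) (from g y))                  ≡⟨ cong σ (clique _ _ x∈ y∈ x'≢y') ⟩
    σ i                                          ∎
    where
    x'≢y' : from g x ≢ from g y
    x'≢y' = x≢y ∘ from-injective g
  image-maximal : ∀ z → S (from g z) ≡ false → (∀ x → S (from g x) ≡ true → c x z ≡ σ i) → ⊥
  -- Pull the adjacencies back along the inverse of g and apply the maximality of S.
  image-maximal z z∉ adjacent = maximal (from g z) z∉ λ s s∈S → begin
    c s (from g z)                  ≡⟨ cong₂ c (sym (from-to g s)) refl ⟩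
    c (from g (to g s)) (from g z)  ≡⟨ c-g⁻¹ (to g s) z
      (λ { refl → contradiction (trans (sym s∈S) (trans (cong S (sym (from-to g s))) z∉)) λ () }) ⟩
    σ⁻¹ (c (to g s) z)              ≡⟨ cong σ⁻¹ (adjacent (to g s) (trans (cong S (from-to g s)) s∈S)) ⟩
    σ⁻¹ (σ i)                       ≡⟨ σ⁻¹σi ⟩
    i                               ∎
    where
    -- The two colour maps are only controlled on colours that occur, so an actual pair of colour i
    -- is needed.
    σ⁻¹σi : σ⁻¹ (σ i) ≡ i
    σ⁻¹σi with parts-nonempty i
    ... | x , y , x≢y , refl = σ⁻¹σ x y x≢y

-- From the factorisation to the plane

module _ (G E : Perm → Set) (c : V → V → Fin 5) (H : Hyp611 G E c) where
  open Factorisation G E c H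

  frame : Frame colour
  frame = record
    { t = λ i → to (t i)
    ; additive = λ i → E-additive (t∈E i)
    ; involutive = involutive
    ; anticommute = anticommute
    ; eigen⇒colour = eigen⇒colour
    ; x = v 0F
    ; x≢0 = v≢0 0F
    ; t₀x≡x = tv≡v 0F
    ; enumeration = Construction.φ 0F ⨾ combineᵇ 9 9
    }

  spreadColouring : SpreadColouring c
  spreadColouring = record
    { ψ = ψ
    ; Γ = Γ
    ; Γ-mate = Γ-mate
    -- Γ assigns to the slope found for j some colour with the class of j, and `classOf` is
    -- injective.
    ; Γ-onto = λ j → proj₁ (slopeOf j) , classOf-injective (proj₂ (colourOf-slope (proj₁ (slopeOf j))))
    ; c-slope = λ n x y x≢y x∼y → trans (c≡colour x y x≢y) (trans (cong colour (difference x y))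
        (Γ-colour n (to ψ y -ₚ to ψ x) (λ eq → x≢y (to-injective ψ (sym (-ₚ≡0 eq)))) x∼y))
    }
    where
    open Coordinates colour frame
    difference : ∀ x y → y +ᵥ (f2 ∙ x) ≡ L (to ψ y -ₚ to ψ x)
    difference x y = sym (trans (L-sub (to ψ y) (to ψ x))
      (cong₂ (λ u w → u +ᵥ (f2 ∙ w)) (from-to ψ y) (from-to ψ x)))

theorem6p11 : (G E : Perm → Set) (c : V → V → Fin 5) →
    Hyp611 G E c → Concl611 G c
theorem6p11 G E c H = record
  { blocks-size9 = block-size
  ; ninety = ninety-blocks
  ; cover = λ x y _ → block-through x y
  ; unique = block-unique
  ; G≤Aut = automorphism (Hyp611.homfact H)
  ; G-2trans = Hyp611.G-2trans H
  ; nearfield = SpreadColouring.ψ C , nearfield-lines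
  }
  where
  C : SpreadColouring c
  C = spreadColouring G E c H
  open Plane c C
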